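{- The monoid $\mathbb{L}$ of lex-minimal extensions is an inductive limit of the increasing system $(\langle L_k(\mathbb{I}_k)\rangle)_{k\in\mathbb{N}}$ of finitely presented monoids. Moreover, $(\mathbf{Atom}\cap L_k(\mathbb{I}_k))_{k\in\mathbb{N}}$ is an increasing system of generators of $(\langle L_k(\mathbb{I}_k)\rangle)_{k\in\mathbb{N}}$ (that is, these sets increase with $k$ and $\mathbf{Atom}\cap L_k(\mathbb{I}_k)$ generates $\langle L_k(\mathbb{I}_k)\rangle$ for each $k$).
   Context: $\mathbb{N}=\{1,2,3,\dots\}$. A sequence $(e_i)_{i\le m}$ of nonnegative integers, where $m\in\mathbb{N}$ (finite sequence of length $m$) or $m=\infty$ (infinite sequence indexed by $\mathbb{N}$), is a binomid index if $\sum_{i=n-k+1}^{n}e_i\ge\sum_{i=1}^k e_i$ for all $k,n\in\mathbb{N}$ with $1\le k\le n\le m$. $\mathbb{I}$ is the set of all infinite binomid indices, and $\mathbb{I}_k$ the set of all finite binomid indices of length $k$. Every finite binomid index $\eta$ extends to an infinite binomid index having $\eta$ as its initial segment; among all such extensions there is a unique lexicographically minimal one, denoted $\tilde\eta$ and called the lex-minimal extension of $\eta$. $\mathbb{L}\subseteq\mathbb{I}$ is the set of all lex-minimal extensions of finite binomid indices; it is known to be a commutative monoid under componentwise addition. The map $L_k:\mathbb{I}_k\to\mathbb{L}$ is $L_k(\eta)=\tilde\eta$. For a subset $A$ of a monoid $M$ with identity $0$, $\langle A\rangle=\{\mu_1+\dots+\mu_n\mid \mu_i\in A,\ n\in\mathbb{N}\}\cup\{0\}$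 is the submonoid generated by $A$; here $\langle L_k(\mathbb{I}_k)\rangle$ is taken in $\mathbb{L}$. An infinite binomid index $\eta$ is atomic if there are no nonzero (infinite) binomid indices $\eta_1,\eta_2$ with $\eta=\eta_1+\eta_2$; $\mathbf{Atom}$ is the set of all nonzero atomic infinite binomid indices. The maps in the increasing system are the inclusions. -}

module Defs where

open import Level using (Level; 0ℓ; _⊔_; suc)
open import Algebra.Bundles using (Monoid; CommutativeMonoid)
import Algebra.Construct.Pointwise as Pointwise
open import Algebra.Morphism.Bundles using (MonoidHomomorphism)
open import Algebra.Morphism.Structures using (IsMonoidIsomorphism)
open import Data.Bool using (if_then_else_)
open import Data.Empty using (⊥-elim)
open import Data.Fin as Fin using (Fin; toℕ; fromℕ<)
import Data.Fin.Properties as Fin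
open import Data.List using (List; []; _∷_; _++_; applyUpTo; foldr)
open import Data.List.Membership.Propositional using (_∈_)
open import Data.List.Properties using (++-assoc; ++-identityʳ)
open import Data.List.Relation.Unary.All using (All; []; _∷_)
import Data.List.Relation.Unary.All.Properties as All
open import Data.Nat as ℕ hiding (_⊔_; suc)
open import Data.Nat using () renaming (suc to 1+)
open import Data.Nat.DivMod using (_%_; m≡m%n+[m/n]*n; m%n<n)
open import Data.Nat.Induction using (<-rec)
open import Data.Nat.ListAction using (sum)
open import Data.Nat.Properties
open import Data.Nat.Solver using (module +-*-Solver)
open import Data.Product using (Σ; Σ-syntax; ∃; ∃₂; ∃-syntax; _×_; _,_; proj₁; proj₂)
open import Data.Sum using (inj₁; inj₂)
open import Data.Vec using (Vec; []; _∷_; lookup; tabulate)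
open import Data.Vec.Properties using (lookup∘tabulate)
open import Function using (_∘_)
open import Relation.Binary using (tri<; tri≈; tri>)
open import Relation.Binary.PropositionalEquality
open import Relation.Nullary using (¬_; yes; no; does)
open import Relation.Nullary.Decidable using (dec-true; dec-false)
open import Relation.Unary using (Pred; _⊆_)

module _ {a ℓ : Level} (M : CommutativeMonoid a ℓ) where
  private module M = CommutativeMonoid M
  open M using (Carrier; _≈_; _∙_; ε)

  subMonoid : ∀ {p} (P : Pred Carrier p) → P ε → (∀ {x y} → P x → P y → P (x ∙ y)) →
              CommutativeMonoid (a ⊔ p) ℓ
  subMonoid P ε∈ ∙∈ = record
    { Carrier = Σ Carrier P
    ; _≈_     = λ x y → proj₁ x ≈ proj₁ y
    ; _∙_     = λ (x , p) (y , q) → x ∙ y , ∙∈ p q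
    ; ε       = ε , ε∈
    ; isCommutativeMonoid = record
      { isMonoid = record
        { isSemigroup = record
          { isMagma = record
            { isEquivalence = record { refl = M.refl ; sym = M.sym ; trans = M.trans }
            ; ∙-cong        = M.∙-cong
            }
          ; assoc = λ x y z → M.assoc (proj₁ x) (proj₁ y) (proj₁ z)
          }
        ; identity = (λ x → M.identityˡ (proj₁ x)) , (λ x → M.identityʳ (proj₁ x))
        }
      ; comm = λ x y → M.comm (proj₁ x) (proj₁ y)
      }
    }

module Generated {a ℓ : Level} (M : CommutativeMonoid a ℓ) where
  open CommutativeMonoid M
    renaming (refl to ≈-refl; sym to ≈-sym; trans to ≈-trans)

  product : List Carrier → Carrier
  product = foldr _∙_ ε

  ⟨_⟩ : ∀ {p} → Pred Carrier p → Pred Carrier (a ⊔ ℓ ⊔ p)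
  ⟨ A ⟩ x = ∃[ xs ] All A xs × x ≈ product xs

  product-++ : ∀ xs ys → product (xs ++ ys) ≈ product xs ∙ product ys
  product-++ []       ys = ≈-sym (identityˡ _)
  product-++ (x ∷ xs) ys =
    ≈-trans (∙-cong ≈-refl (product-++ xs ys)) (≈-sym (assoc _ _ _))

  ⟨⟩-closed : ∀ {p} (A : Pred Carrier p) {x y} → ⟨ A ⟩ x → ⟨ A ⟩ y → ⟨ A ⟩ (x ∙ y)
  ⟨⟩-closed A (xs , pxs , x≈) (ys , pys , y≈) =
    xs ++ ys , All.++⁺ pxs pys , ≈-trans (∙-cong x≈ y≈) (≈-sym (product-++ xs ys))

  ⟨_⟩ᴹ : ∀ {p} → Pred Carrier p → CommutativeMonoid (a ⊔ ℓ ⊔ p) ℓ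
  ⟨ A ⟩ᴹ = subMonoid M ⟨ A ⟩ ([] , [] , ≈-refl) (⟨⟩-closed A)

Increasing : ∀ {a p} {X : Set a} → (ℕ → Pred X p) → Set (a ⊔ p)
Increasing A = ∀ {i j} → i ≤ j → A i ⊆ A j

Word : ℕ → Set
Word n = List (Fin n)

-- The least congruence on the free monoid containing the listed pairs.

data Congruence {n} (R : List (Word n × Word n)) : Word n → Word n → Set where
  rel    : ∀ {u v} → (u , v) ∈ R → Congruence R u v
  ≈refl  : ∀ {u} → Congruence R u u
  ≈sym   : ∀ {u v} → Congruence R u v → Congruence R v u
  ≈trans : ∀ {u v w} → Congruence R u v → Congruence R v w → Congruence R u w
  ≈++    : ∀ {u u′ v v′} → Congruence R u u′ → Congruence R v v′ →
           Congruence R (u ++ v) (u′ ++ v′)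

presented : ∀ n → List (Word n × Word n) → Monoid 0ℓ 0ℓ
presented n R = record
  { Carrier = Word n
  ; _≈_     = Congruence R
  ; _∙_     = _++_
  ; ε       = []
  ; isMonoid = record
    { isSemigroup = record
      { isMagma = record
        { isEquivalence = record { refl = ≈refl ; sym = ≈sym ; trans = ≈trans }
        ; ∙-cong        = ≈++
        }
      ; assoc = λ u v w → ≡⇒≈ (++-assoc u v w)
      }
    ; identity = (λ _ → ≈refl) , (λ u → ≡⇒≈ (++-identityʳ u))
    }
  }
  where
  ≡⇒≈ : ∀ {u v} → u ≡ v → Congruence R u v
  ≡⇒≈ refl = ≈refl

FinitelyPresented : ∀ {a ℓ} → Monoid a ℓ → Set (a ⊔ ℓ)
FinitelyPresented M =
  Σ[ n ∈ ℕ ] Σ[ R ∈ List (Word n × Word n) ] ∃[ f ]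
    IsMonoidIsomorphism (Monoid.rawMonoid (presented n R)) (Monoid.rawMonoid M) f

Hom : ∀ {a ℓ b ℓ′} → Monoid a ℓ → Monoid b ℓ′ → Set (a ⊔ ℓ ⊔ b ⊔ ℓ′)
Hom M N = MonoidHomomorphism (Monoid.rawMonoid M) (Monoid.rawMonoid N)

open MonoidHomomorphism using (⟦_⟧) public

record InductiveSystem (a ℓ : Level) : Set (suc (a ⊔ ℓ)) where
  field
    obj  : ℕ → Monoid a ℓ
    map  : ∀ {i j} → i ≤ j → Hom (obj i) (obj j)
    map-id : ∀ {i} (p : i ≤ i) x → Monoid._≈_ (obj i) (⟦ map p ⟧ x) x
    map-∘  : ∀ {i j k} (p : i ≤ j) (q : j ≤ k) (r : i ≤ k) x →
             Monoid._≈_ (obj k) (⟦ map r ⟧ x) (⟦ map q ⟧ (⟦ map p ⟧ x))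

module _ {a ℓ : Level} (D : InductiveSystem a ℓ) where
  open InductiveSystem D

  Compatible : ∀ {b ℓ′} (N : Monoid b ℓ′) → (∀ i → Hom (obj i) N) → Set (a ⊔ ℓ′)
  Compatible N f =
    ∀ {i j} (p : i ≤ j) x → Monoid._≈_ N (⟦ f j ⟧ (⟦ map p ⟧ x)) (⟦ f i ⟧ x)

  -- The levels c and ℓ″ are those of the monoids tested against.

  record IsInductiveLimit {b ℓ′} (c ℓ″ : Level) (M : Monoid b ℓ′)
                          (ι : ∀ i → Hom (obj i) M) :
                          Set (a ⊔ ℓ ⊔ b ⊔ ℓ′ ⊔ suc (c ⊔ ℓ″)) where
    field
      compatible : Compatible M ι
      universal  : (N : Monoid c ℓ″) (f : ∀ i → Hom (obj i) N) → Compatible N f →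
        let open Monoid N using (_≈_)
            Mediates : Hom M N → Set (a ⊔ ℓ″)
            Mediates u = ∀ i x → ⟦ u ⟧ (⟦ ι i ⟧ x) ≈ ⟦ f i ⟧ x
        in Σ[ u ∈ Hom M N ] Mediates u ×
           (∀ v → Mediates v → ∀ x → ⟦ v ⟧ x ≈ ⟦ u ⟧ x)

module _ {a ℓ p : Level} (M : CommutativeMonoid a ℓ) where
  open CommutativeMonoid M using (Carrier) renaming (refl to ≈-refl)
  open Generated M

  inclusionSystem : (A : ℕ → Pred Carrier p) → Increasing (λ k → ⟨ A k ⟩) →
                    InductiveSystem (a ⊔ ℓ ⊔ p) ℓ
  inclusionSystem A inc = record
    { obj    = λ k → CommutativeMonoid.monoid ⟨ A k ⟩ᴹ
    ; map    = λ i≤j → record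
      { ⟦_⟧ = λ (x , x∈) → x , inc i≤j x∈
      ; isMonoidHomomorphism = record
        { isMagmaHomomorphism = record
          { isRelHomomorphism = record { cong = λ x≈y → x≈y }
          ; homo              = λ _ _ → ≈-refl
          }
        ; ε-homo = ≈-refl
        }
      }
    ; map-id = λ _ _ → ≈-refl
    ; map-∘  = λ _ _ _ _ → ≈-refl
    }

  inclusion : (A : Pred Carrier p) →
              Hom (CommutativeMonoid.monoid ⟨ A ⟩ᴹ) (CommutativeMonoid.monoid M)
  inclusion A = record
    { ⟦_⟧ = proj₁
    ; isMonoidHomomorphism = record
      { isMagmaHomomorphism = record
        { isRelHomomorphism = record { cong = λ x≈y → x≈y }
        ; homo              = λ _ _ → ≈-refl
        }
      ; ε-homo = ≈-refl
      }
    }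

-- Sequences are indexed from 0: the value e i is the term e_{i+1}, so
-- ∑ e a k = e_{a+1} + ⋯ + e_{a+k}.

Seq : Set
Seq = ℕ → ℕ

∑ : Seq → ℕ → ℕ → ℕ
∑ e a k = sum (applyUpTo (λ i → e (a + i)) k)

TailBound : Seq → ℕ → ℕ → Set
TailBound e k n = ∑ e (n ∸ k) k ≥ ∑ e 0 k

IsBinomid : Seq → Set
IsBinomid e = ∀ k n → 1 ≤ k → k ≤ n → TailBound e k n

-- The padding is never read in IsFiniteBinomid, as k ≤ n ≤ m there.

pad : ∀ {m} → Vec ℕ m → Seq
pad []       _      = 0
pad (x ∷ xs) zero   = x
pad (x ∷ xs) (1+ i) = pad xs i

IsFiniteBinomid : ∀ {m} → Vec ℕ m → Set
IsFiniteBinomid {m} η = ∀ k n → 1 ≤ k → k ≤ n → n ≤ m → TailBound (pad η) k n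

𝕀[_] : ℕ → Set
𝕀[ m ] = Σ (Vec ℕ m) IsFiniteBinomid

Extends : ∀ {m} → Vec ℕ m → Seq → Set
Extends η ζ = ∀ i → ζ (toℕ i) ≡ lookup η i

infix 4 _<ˡᵉˣ_

_<ˡᵉˣ_ : Seq → Seq → Set
ξ <ˡᵉˣ ζ = ∃[ n ] (∀ i → i < n → ξ i ≡ ζ i) × ξ n < ζ n

record IsLexMinExtension {m} (η : Vec ℕ m) (ζ : Seq) : Set where
  field
    isBinomid : IsBinomid ζ
    extends   : Extends η ζ
    minimal   : ∀ ξ → IsBinomid ξ → Extends η ξ → ¬ (ξ <ˡᵉˣ ζ)

-- Lengths of finite indices are positive, hence the successor.

IsLexMinimal : Seq → Set
IsLexMinimal ζ = ∃[ k ] Σ[ (η , _) ∈ 𝕀[ 1+ k ] ] IsLexMinExtension η ζ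

S : Seq → ℕ → ℕ
S e n = ∑ e 0 n

S-suc : ∀ e n → S e (1+ n) ≡ S e n + e n
S-suc e zero   = +-comm (e 0) 0
S-suc e (1+ n) =
  trans (cong (e 0 +_) (S-suc (e ∘ 1+) n)) (sym (+-assoc (e 0) _ _))

S-+ : ∀ e a k → S e (a + k) ≡ S e a + ∑ e a k
S-+ e zero   k = refl
S-+ e (1+ a) k =
  trans (cong (e 0 +_) (S-+ (e ∘ 1+) a k)) (sym (+-assoc (e 0) _ _))

S-cong : ∀ {e f} n → (∀ i → i < n → e i ≡ f i) → S e n ≡ S f n
S-cong zero   eq = refl
S-cong (1+ n) eq = cong₂ _+_ (eq 0 z<s) (S-cong n (λ i i<n → eq (1+ i) (s<s i<n)))

S-distrib : ∀ e f n → S (λ i → e i + f i) n ≡ S e n + S f n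
S-distrib e f zero   = refl
S-distrib e f (1+ n) =
  trans (cong (e 0 + f 0 +_) (S-distrib (e ∘ 1+) (f ∘ 1+) n))
        (solve 4 (λ a b c d → a :+ b :+ (c :+ d) := (a :+ c) :+ (b :+ d)) refl
          (e 0) (f 0) _ _)
  where open +-*-Solver

SuperAt : Seq → ℕ → Set
SuperAt e n = ∀ a b → a + b ≡ n → S e a + S e b ≤ S e n

tails⇒super : ∀ e n → (∀ k → 1 ≤ k → k ≤ n → TailBound e k n) → SuperAt e n
tails⇒super e n tails a zero   eq =
  ≤-reflexive (trans (+-identityʳ _) (cong (S e) (trans (sym (+-identityʳ a)) eq)))
tails⇒super e n tails a b@(1+ _) refl = begin
  S e a + S e b          ≤⟨ +-monoʳ-≤ (S e a) (tails b (s≤s z≤n) (m≤n+m b a)) ⟩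
  S e a + ∑ e (a + b ∸ b) b ≡⟨ cong (λ x → S e a + ∑ e x b) (m+n∸n≡m a b) ⟩
  S e a + ∑ e a b        ≡⟨ S-+ e a b ⟨
  S e (a + b)            ∎
  where open ≤-Reasoning

super⇒tail : ∀ e n k → k ≤ n → SuperAt e n → TailBound e k n
super⇒tail e n k k≤n sup = +-cancelˡ-≤ (S e (n ∸ k)) _ _ (begin
  S e (n ∸ k) + S e k        ≤⟨ sup (n ∸ k) k (m∸n+n≡m k≤n) ⟩
  S e n                      ≡⟨ cong (S e) (m∸n+n≡m k≤n) ⟨
  S e (n ∸ k + k)            ≡⟨ S-+ e (n ∸ k) k ⟩
  S e (n ∸ k) + ∑ e (n ∸ k) k ∎)
  where open ≤-Reasoning

binomid⇒super : ∀ {e} → IsBinomid e → ∀ n → SuperAt e n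
binomid⇒super {e} be n = tails⇒super e n (λ k → be k n)

super⇒binomid : ∀ {e} → (∀ n → SuperAt e n) → IsBinomid e
super⇒binomid {e} sup k n _ k≤n = super⇒tail e n k k≤n (sup n)

SuperAt-cong : ∀ {e f} n → (∀ i → i < n → e i ≡ f i) → SuperAt e n → SuperAt f n
SuperAt-cong {e} {f} n eq sup a b refl = begin
  S f a + S f b ≡⟨ cong₂ _+_ (S-cong a λ i i<a → eq i (<-≤-trans i<a (m≤m+n a b)))
                             (S-cong b λ i i<b → eq i (<-≤-trans i<b (m≤n+m b a))) ⟨
  S e a + S e b ≤⟨ sup a b refl ⟩
  S e (a + b)   ≡⟨ S-cong (a + b) eq ⟩
  S f (a + b)   ∎
  where open ≤-Reasoning

S-mono : ∀ e a b → S e a ≤ S e (a + b)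
S-mono e a b = ≤-trans (m≤m+n (S e a) _) (≤-reflexive (sym (S-+ e a b)))

pad-lookup : ∀ {m} (η : Vec ℕ m) i → pad η (toℕ i) ≡ lookup η i
pad-lookup (x ∷ η) Fin.zero    = refl
pad-lookup (x ∷ η) (Fin.suc i) = pad-lookup η i

extends⇒pad : ∀ {m} (η : Vec ℕ m) {ζ} → Extends η ζ → ∀ i → i < m → ζ i ≡ pad η i
extends⇒pad η {ζ} ext i i<m =
  subst (λ j → ζ j ≡ pad η j) (Fin.toℕ-fromℕ< i<m)
        (trans (ext (fromℕ< i<m)) (sym (pad-lookup η (fromℕ< i<m))))

prefix : ∀ m → Seq → Vec ℕ m
prefix m e = tabulate (e ∘ toℕ)

prefix-extends : ∀ m e → Extends (prefix m e) e
prefix-extends m e i = sym (lookup∘tabulate (e ∘ toℕ) i)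

prefix-binomid : ∀ m {e} → IsBinomid e → IsFiniteBinomid (prefix m e)
prefix-binomid m {e} be k n 1≤k k≤n n≤m =
  super⇒tail (pad (prefix m e)) n k k≤n
    (SuperAt-cong n
      (λ i i<n → extends⇒pad (prefix m e) (prefix-extends m e) i (<-≤-trans i<n n≤m))
      (binomid⇒super be n))

maxUpTo : Seq → ℕ → ℕ
maxUpTo g zero   = 0
maxUpTo g (1+ n) = g n ℕ.⊔ maxUpTo g n

maxUpTo-ub : ∀ g n i → i < n → g i ≤ maxUpTo g n
maxUpTo-ub g (1+ n) i i<1+n with m≤n⇒m<n∨m≡n (s≤s⁻¹ i<1+n)
... | inj₁ i<n  = ≤-trans (maxUpTo-ub g n i i<n) (m≤n⊔m (g n) _)
... | inj₂ refl = m≤m⊔n (g n) _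

maxUpTo-lub : ∀ g n {v} → (∀ i → i < n → g i ≤ v) → maxUpTo g n ≤ v
maxUpTo-lub g zero   ub = z≤n
maxUpTo-lub g (1+ n) ub =
  ⊔-lub (ub n (n<1+n n)) (maxUpTo-lub g n (λ i i<n → ub i (m<n⇒m<1+n i<n)))

maxUpTo-cong : ∀ {g h} n → (∀ i → i < n → g i ≡ h i) → maxUpTo g n ≡ maxUpTo h n
maxUpTo-cong zero   eq = refl
maxUpTo-cong (1+ n) eq =
  cong₂ ℕ._⊔_ (eq n (n<1+n n)) (maxUpTo-cong n (λ i i<n → eq i (m<n⇒m<1+n i<n)))

maxUpTo-attained : ∀ g n → 1 ≤ n → ∃[ i ] i < n × maxUpTo g n ≡ g i
maxUpTo-attained g 1                _ = 0 , z<s , ⊔-identityʳ (g 0)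
maxUpTo-attained g (1+ (1+ n)) _
  with i , i<n , eq ← maxUpTo-attained g (1+ n) (s≤s z≤n)
     | ⊔-sel (g (1+ n)) (maxUpTo g (1+ n))
... | inj₁ eq′ = 1+ n , n<1+n (1+ n) , eq′
... | inj₂ eq′ = i , m<n⇒m<1+n i<n , trans eq′ eq

-- The least admissible value of f n, given f 0, …, f (n ∸ 1).

splitSum : Seq → ℕ → ℕ → ℕ
splitSum f n k = S f (1+ k) + S f (n ∸ k)

need : Seq → ℕ → ℕ
need f n = maxUpTo (splitSum f n) n ∸ S f n

need-cong : ∀ {f g} n → (∀ i → i < n → f i ≡ g i) → need f n ≡ need g n
need-cong n eq = cong₂ _∸_
  (maxUpTo-cong n λ k k<n → cong₂ _+_
    (S-cong (1+ k) λ i i<1+k → eq i (<-≤-trans i<1+k k<n))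
    (S-cong (n ∸ k) λ i i<n∸k → eq i (<-≤-trans i<n∸k (m∸n≤m n k))))
  (S-cong n eq)

need≤ : ∀ {f} n → SuperAt f (1+ n) → need f n ≤ f n
need≤ {f} n sup = m≤n+o⇒m∸n≤o _ _ (begin
  maxUpTo (splitSum f n) n ≤⟨ maxUpTo-lub (splitSum f n) n (λ k k<n →
                                sup (1+ k) (n ∸ k) (cong 1+ (m+[n∸m]≡n (<⇒≤ k<n)))) ⟩
  S f (1+ n)               ≡⟨ S-suc f n ⟩
  S f n + f n              ∎)
  where open ≤-Reasoning

need⇒super : ∀ {f} n → need f n ≤ f n → SuperAt f (1+ n)
need⇒super {f} n nd zero   b refl = ≤-refl
need⇒super {f} n nd (1+ a) b eq with m≤n⇒m<n∨m≡n (subst (a ≤_) (suc-injective eq) (m≤m+n a b))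
... | inj₂ refl with refl ← +-cancelˡ-≡ a b 0 (trans (suc-injective eq) (sym (+-identityʳ a))) =
  ≤-reflexive (+-identityʳ _)
... | inj₁ a<n = begin
  S f (1+ a) + S f b                   ≡⟨ cong (λ x → S f (1+ a) + S f x) b≡ ⟩
  splitSum f n a                       ≤⟨ maxUpTo-ub (splitSum f n) n a a<n ⟩
  maxUpTo (splitSum f n) n             ≤⟨ m≤n+m∸n _ (S f n) ⟩
  S f n + need f n                     ≤⟨ +-monoʳ-≤ (S f n) nd ⟩
  S f n + f n                          ≡⟨ S-suc f n ⟨
  S f (1+ n)                           ∎
  where
  open ≤-Reasoning
  b≡ : b ≡ n ∸ a
  b≡ = trans (sym (m+n∸m≡n a b)) (cong (_∸ a) (suc-injective eq))

module Completion (m : ℕ) (e : Seq) where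

  next : ℕ → Seq → ℕ
  next n f = if does (n <? m) then e n else need f n

  approx : ℕ → Seq
  approx zero   i = 0
  approx (1+ n) i = if does (i <? n) then approx n i else next n (approx n)

  complete : Seq
  complete i = approx (1+ i) i

  complete≡ : ∀ n → complete n ≡ next n (approx n)
  complete≡ n =
    cong (if_then approx n n else next n (approx n)) (dec-false (n <? n) (<-irrefl refl))

  approx≡ : ∀ n i → i < n → approx n i ≡ complete i
  approx≡ (1+ n) i i<1+n with m≤n⇒m<n∨m≡n (s≤s⁻¹ i<1+n)
  ... | inj₁ i<n  =
    trans (cong (if_then approx n i else next n (approx n)) (dec-true (i <? n) i<n))
          (approx≡ n i i<n)
  ... | inj₂ refl = refl

  complete-< : ∀ n → n < m → complete n ≡ e n
  complete-< n n<m = trans (complete≡ n)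
    (cong (if_then e n else need (approx n) n) (dec-true (n <? m) n<m))

  complete-≥ : ∀ n → m ≤ n → complete n ≡ need complete n
  complete-≥ n m≤n = trans (complete≡ n) (trans
    (cong (if_then e n else need (approx n) n) (dec-false (n <? m) (≤⇒≯ m≤n)))
    (need-cong n (approx≡ n)))

lexMinExtension : ∀ {m} (η : 𝕀[ m ]) → ∃[ ζ ] IsLexMinExtension (proj₁ η) ζ
lexMinExtension {m} (η , bη) = complete , record
  { isBinomid = super⇒binomid super
  ; extends   = λ i → trans (complete-< (toℕ i) (Fin.toℕ<n i)) (pad-lookup η i)
  ; minimal   = minimal
  }
  where
  open Completion m (pad η)

  super : ∀ n → SuperAt complete n
  super n with n ≤? m
  ... | yes n≤m = SuperAt-cong n (λ i i<n → sym (complete-< i (<-≤-trans i<n n≤m)))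
                    (tails⇒super (pad η) n (λ k 1≤k k≤n → bη k n 1≤k k≤n n≤m))
  super zero   | no n≰m = ⊥-elim (n≰m z≤n)
  super (1+ n) | no n≰m =
    need⇒super n (≤-reflexive (sym (complete-≥ n (s≤s⁻¹ (≰⇒> n≰m)))))

  minimal : ∀ ξ → IsBinomid ξ → Extends η ξ → ¬ (ξ <ˡᵉˣ complete)
  minimal ξ bξ ext (n , eq , lt) with n <? m
  ... | yes n<m = <-irrefl (trans (extends⇒pad η ext n n<m) (sym (complete-< n n<m))) lt
  ... | no n≮m  = <⇒≱ lt (begin
    complete n      ≡⟨ complete-≥ n (≮⇒≥ n≮m) ⟩
    need complete n ≡⟨ need-cong n eq ⟨
    need ξ n        ≤⟨ need≤ n (binomid⇒super bξ (1+ n)) ⟩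
    ξ n             ∎)
    where open ≤-Reasoning

lexMinExtension-unique : ∀ {m} {η : Vec ℕ m} {ζ ξ} →
  IsLexMinExtension η ζ → IsLexMinExtension η ξ → ∀ i → ζ i ≡ ξ i
lexMinExtension-unique {ζ = ζ} {ξ} mζ mξ = <-rec _ λ i rec → step i (λ j j<i → rec j<i)
  where
  module ζ = IsLexMinExtension mζ
  module ξ = IsLexMinExtension mξ
  step : ∀ i → (∀ j → j < i → ζ j ≡ ξ j) → ζ i ≡ ξ i
  step i eq with <-cmp (ζ i) (ξ i)
  ... | tri< lt _ _ = ⊥-elim (ξ.minimal ζ ζ.isBinomid ζ.extends (i , eq , lt))
  ... | tri≈ _ e _  = e
  ... | tri> _ _ gt =
    ⊥-elim (ζ.minimal ξ ξ.isBinomid ξ.extends (i , (λ j j<i → sym (eq j j<i)) , gt))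

-- A binomid index is the lex-minimal extension of its segment of length
-- m ≥ 1 exactly when S attains superadditivity at every n > m.

Splits : Seq → ℕ → Set
Splits e m = ∀ n → m < n →
  ∃₂ λ a b → 1 ≤ a × 1 ≤ b × a + b ≡ n × S e n ≡ S e a + S e b

lexMin⇒splits : ∀ {k} (η : 𝕀[ 1+ k ]) {ζ} →
                IsLexMinExtension (proj₁ η) ζ → Splits ζ (1+ k)
lexMin⇒splits {k} η {ζ} mζ (1+ n) (s≤s m≤n) =
  let 1≤n = ≤-trans (s≤s z≤n) m≤n
      i , i<n , eq = maxUpTo-attained (splitSum ζ n) n 1≤n
  in 1+ i , n ∸ i , s≤s z≤n , m<n⇒0<n∸m i<n , cong 1+ (m+[n∸m]≡n (<⇒≤ i<n)) , (begin
    S ζ (1+ n)                   ≡⟨ S-suc ζ n ⟩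
    S ζ n + ζ n                  ≡⟨ cong (S ζ n +_) ζn ⟩
    S ζ n + need ζ n             ≡⟨ m+[n∸m]≡n (≤-trans (m≤n+m (S ζ n) (S ζ 1))
                                      (maxUpTo-ub (splitSum ζ n) n 0 1≤n)) ⟩
    maxUpTo (splitSum ζ n) n     ≡⟨ eq ⟩
    S ζ (1+ i) + S ζ (n ∸ i)     ∎)
  where
  open ≡-Reasoning
  open Completion (1+ k) (pad (proj₁ η))
  agree : ∀ i → ζ i ≡ complete i
  agree = lexMinExtension-unique mζ (proj₂ (lexMinExtension η))
  ζn : ζ n ≡ need ζ n
  ζn = trans (agree n) (trans (complete-≥ n m≤n) (need-cong n (λ i _ → sym (agree i))))

splits⇒lexMin : ∀ m {e} → IsBinomid e → Splits e m → IsLexMinExtension (prefix m e) e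
splits⇒lexMin m {e} be spl = record
  { isBinomid = be
  ; extends   = prefix-extends m e
  ; minimal   = minimal
  }
  where
  minimal : ∀ ξ → IsBinomid ξ → Extends (prefix m e) ξ → ¬ (ξ <ˡᵉˣ e)
  minimal ξ bξ ext (n , eq , lt) with n <? m
  ... | yes n<m = <-irrefl
    (trans (extends⇒pad (prefix m e) ext n n<m)
           (sym (extends⇒pad (prefix m e) (prefix-extends m e) n n<m))) lt
  ... | no n≮m with a , b , 1≤a , 1≤b , a+b , Sn ← spl (1+ n) (s≤s (≮⇒≥ n≮m)) =
    <⇒≱ lt (+-cancelˡ-≤ (S e n) _ _ (begin
      S e n + e n    ≡⟨ S-suc e n ⟨
      S e (1+ n)     ≡⟨ Sn ⟩
      S e a + S e b  ≡⟨ cong₂ _+_ (agree a a≤n) (agree b b≤n) ⟨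
      S ξ a + S ξ b  ≤⟨ binomid⇒super bξ (1+ n) a b a+b ⟩
      S ξ (1+ n)     ≡⟨ S-suc ξ n ⟩
      S ξ n + ξ n    ≡⟨ cong (_+ ξ n) (agree n ≤-refl) ⟩
      S e n + ξ n    ∎))
    where
    open ≤-Reasoning
    agree : ∀ j → j ≤ n → S ξ j ≡ S e j
    agree j j≤n = S-cong j λ i i<j → eq i (<-≤-trans i<j j≤n)
    a≤n : a ≤ n
    a≤n = s≤s⁻¹ (≤-trans (≤-reflexive (+-comm 1 a))
            (≤-trans (+-monoʳ-≤ a 1≤b) (≤-reflexive a+b)))
    b≤n : b ≤ n
    b≤n = s≤s⁻¹ (≤-trans (+-monoˡ-≤ b 1≤a) (≤-reflexive a+b))

-- S is eventually quasi-periodic.  Take p ≤ m maximising S p / p.  By the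
-- pigeonhole principle any p summands ≤ m of an optimal decomposition of n
-- contain a block whose total is a multiple of p, and that block may be
-- replaced by copies of p.

EventuallyPeriodic : Seq → Set
EventuallyPeriodic e =
  ∃₂ λ p N → 1 ≤ p × (∀ n → N ≤ n → S e (p + n) ≤ S e p + S e n)

module Periodicity {e : Seq} (be : IsBinomid e) (k : ℕ) (spl : Splits e (1+ k)) where
  open ≤-Reasoning

  m : ℕ
  m = 1+ k

  T : ℕ → ℕ
  T = S e

  super : ∀ a b → T a + T b ≤ T (a + b)
  super a b = binomid⇒super be (a + b) a b refl

  peel : ∀ n → m < n → ∃₂ λ q r → 1 ≤ q × q ≤ m × q + r ≡ n × T n ≡ T q + T r
  peel = <-rec _ λ n rec → step n rec
    where
    step : ∀ n → (∀ {j} → j < n → m < j →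
                    ∃₂ λ q r → 1 ≤ q × q ≤ m × q + r ≡ j × T j ≡ T q + T r) →
           m < n → ∃₂ λ q r → 1 ≤ q × q ≤ m × q + r ≡ n × T n ≡ T q + T r
    step n rec m<n with spl n m<n
    ... | a , b , 1≤a , 1≤b , refl , Tn with a ≤? m
    ...   | yes a≤m = a , b , 1≤a , a≤m , refl , Tn
    ...   | no a≰m with q , r , 1≤q , q≤m , refl , Ta ←
              rec (≤-trans (≤-reflexive (+-comm 1 a)) (+-monoʳ-≤ a 1≤b)) (≰⇒> a≰m) =
      q , r + b , 1≤q , q≤m , sym (+-assoc q r b) , ≤-antisym
        (begin
          T (q + r + b)       ≡⟨ Tn ⟩
          T (q + r) + T b     ≡⟨ cong (_+ T b) Ta ⟩
          T q + T r + T b     ≡⟨ +-assoc (T q) _ _ ⟩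
          T q + (T r + T b)   ≤⟨ +-monoʳ-≤ (T q) (super r b) ⟩
          T q + T (r + b)     ∎)
        (begin
          T q + T (r + b)     ≤⟨ super q (r + b) ⟩
          T (q + (r + b))     ≡⟨ cong T (+-assoc q r b) ⟨
          T (q + r + b)       ∎)

  maxRatio : ∀ n → ∃[ j ] j ≤ n ×
             (∀ q → 1 ≤ q → q ≤ 1+ n → T q * 1+ j ≤ q * T (1+ j))
  maxRatio zero = 0 , z≤n , λ
    { (1+ zero) _ _ → ≤-reflexive (*-comm (T 1) 1)
    ; (1+ (1+ _)) _ (s≤s ()) }
  maxRatio (1+ n)
    with j , j≤n , best ← maxRatio n
    with ≤-total (T (1+ (1+ n)) * 1+ j) (1+ (1+ n) * T (1+ j))
  ... | inj₁ old = j , m≤n⇒m≤1+n j≤n , better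
    where
    better : ∀ q → 1 ≤ q → q ≤ 1+ (1+ n) → T q * 1+ j ≤ q * T (1+ j)
    better q 1≤q q≤ with m≤n⇒m<n∨m≡n q≤
    ... | inj₁ q< = best q 1≤q (s≤s⁻¹ q<)
    ... | inj₂ refl = old
  ... | inj₂ new = 1+ n , ≤-refl , better
    where
    N = 1+ (1+ n)
    better : ∀ q → 1 ≤ q → q ≤ N → T q * N ≤ q * T N
    better q 1≤q q≤ with m≤n⇒m<n∨m≡n q≤
    ... | inj₂ refl = ≤-reflexive (*-comm (T N) N)
    ... | inj₁ q< = *-cancelʳ-≤ (T q * N) (q * T N) (1+ j) (begin
      T q * N * 1+ j      ≡⟨ solve 3 (λ a b c → a :* b :* c := a :* c :* b) refl (T q) N (1+ j) ⟩
      T q * 1+ j * N      ≤⟨ *-monoˡ-≤ N (best q 1≤q (s≤s⁻¹ q<)) ⟩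
      q * T (1+ j) * N    ≡⟨ solve 3 (λ a b c → a :* b :* c := a :* (c :* b)) refl q (T (1+ j)) N ⟩
      q * (N * T (1+ j))  ≤⟨ *-monoʳ-≤ q new ⟩
      q * (T N * 1+ j)    ≡⟨ *-assoc q (T N) (1+ j) ⟨
      q * T N * 1+ j      ∎)
      where open +-*-Solver

  module Exchange (j₀ : ℕ) (best : ∀ q → 1 ≤ q → q ≤ m → T q * 1+ j₀ ≤ q * T (1+ j₀)) where

    p : ℕ
    p = 1+ j₀

    ratio : ∀ n → T n * p ≤ n * T p
    ratio = <-rec _ λ n rec → step n rec
      where
      step : ∀ n → (∀ {j} → j < n → T j * p ≤ j * T p) → T n * p ≤ n * T p
      step zero rec = z≤n
      step n@(1+ _) rec with n ≤? m
      ... | yes n≤m = best n (s≤s z≤n) n≤m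
      ... | no n≰m with a , b , 1≤a , 1≤b , a+b , Tn ← spl n (≰⇒> n≰m) = begin
        T n * p             ≡⟨ cong (_* p) Tn ⟩
        (T a + T b) * p     ≡⟨ *-distribʳ-+ p (T a) (T b) ⟩
        T a * p + T b * p   ≤⟨ +-mono-≤
          (rec (subst (a <_) a+b (m<m+n a 1≤b)))
          (rec (subst (b <_) a+b (m<n+m b 1≤a))) ⟩
        a * T p + b * T p   ≡⟨ *-distribʳ-+ (T p) a b ⟨
        (a + b) * T p       ≡⟨ cong (_* T p) a+b ⟩
        n * T p             ∎

    multiples : ∀ t → t * T p ≤ T (t * p)
    multiples zero   = z≤n
    multiples (1+ t) = ≤-trans (+-monoʳ-≤ (T p) (multiples t)) (super p (t * p))

    infix 4 _⊒_
    _⊒_ : ℕ → ℕ → Set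
    x ⊒ y = ∃[ d ] x ≡ d + y × T x ≤ T d + T y

    ⊒-refl : ∀ {x} → x ⊒ x
    ⊒-refl = 0 , refl , ≤-refl

    ⊒-trans : ∀ {x y z} → x ⊒ y → y ⊒ z → x ⊒ z
    ⊒-trans {z = z} (d , refl , Tx) (d′ , refl , Ty) = d + d′ , sym (+-assoc d d′ z) , (begin
      T (d + (d′ + z))     ≤⟨ Tx ⟩
      T d + T (d′ + z)     ≤⟨ +-monoʳ-≤ (T d) Ty ⟩
      T d + (T d′ + T z)   ≡⟨ +-assoc (T d) _ _ ⟨
      T d + T d′ + T z     ≤⟨ +-monoˡ-≤ (T z) (super d d′) ⟩
      T (d + d′) + T z     ∎)

    Step : ℕ → ℕ → Set
    Step x y = x ⊒ y × x ≤ m + y × (m < x → y < x)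

    stepFrom : ∀ x → ∃ (Step x)
    stepFrom x with x ≤? m
    ... | yes x≤m = x , ⊒-refl , m≤n+m x m , λ m<x → ⊥-elim (<⇒≱ m<x x≤m)
    ... | no x≰m with q , r , 1≤q , q≤m , refl , Tx ← peel x (≰⇒> x≰m) =
      r , (q , refl , ≤-reflexive Tx) , +-monoˡ-≤ r q≤m , λ _ → m<n+m r 1≤q

    rest : ℕ → ℕ → ℕ
    rest n zero   = n
    rest n (1+ i) = proj₁ (stepFrom (rest n i))

    rest-large : ∀ n i → n ≤ i * m + rest n i
    rest-large n zero   = ≤-refl
    rest-large n (1+ i) = begin
      n                               ≤⟨ rest-large n i ⟩
      i * m + rest n i                ≤⟨ +-monoʳ-≤ (i * m)
                                          (proj₁ (proj₂ (proj₂ (stepFrom (rest n i))))) ⟩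
      i * m + (m + rest n (1+ i))     ≡⟨ solve 3 (λ a b c → a :+ (b :+ c) := b :+ a :+ c) refl
                                          (i * m) m (rest n (1+ i)) ⟩
      1+ i * m + rest n (1+ i)        ∎
      where open +-*-Solver

    rest-⊒ : ∀ n i d → rest n i ⊒ rest n (d + i)
    rest-⊒ n i zero   = ⊒-refl
    rest-⊒ n i (1+ d) =
      ⊒-trans (rest-⊒ n i d) (proj₁ (proj₂ (stepFrom (rest n (d + i)))))

    bound : ℕ
    bound = 1+ (m + p * m)

    rest->m : ∀ n i → bound ≤ n → i ≤ p → m < rest n i
    rest->m n i N≤n i≤p = +-cancelˡ-≤ (p * m) _ _ (begin
      p * m + 1+ m      ≡⟨ +-comm (p * m) (1+ m) ⟩
      bound             ≤⟨ N≤n ⟩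
      n                 ≤⟨ rest-large n i ⟩
      i * m + rest n i  ≤⟨ +-monoˡ-≤ (rest n i) (*-monoˡ-≤ m i≤p) ⟩
      p * m + rest n i  ∎)

    rest-decreasing : ∀ n i d → bound ≤ n → 1+ d + i ≤ p → rest n (1+ d + i) < rest n i
    rest-decreasing n i d N≤n le with x , eq , _ ← rest-⊒ n i d = begin-strict
      rest n (1+ d + i)  <⟨ proj₂ (proj₂ (proj₂ (stepFrom (rest n (d + i)))))
                             (rest->m n (d + i) N≤n (≤-trans (n≤1+n _) le)) ⟩
      rest n (d + i)     ≤⟨ m≤n+m _ x ⟩
      x + rest n (d + i) ≡⟨ eq ⟨
      rest n i           ∎

    residue : ℕ → Fin (1+ p) → Fin p
    residue n i = fromℕ< (m%n<n (rest n (toℕ i)) p)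

    residue≡ : ∀ n i j → residue n i ≡ residue n j →
               rest n (toℕ i) % p ≡ rest n (toℕ j) % p
    residue≡ n i j eq =
      trans (sym (Fin.toℕ-fromℕ< (m%n<n (rest n (toℕ i)) p)))
            (trans (cong toℕ eq) (Fin.toℕ-fromℕ< (m%n<n (rest n (toℕ j)) p)))

    multipleOfp : ∀ d y → 1 ≤ d → (d + y) % p ≡ y % p → ∃[ t ] d ≡ 1+ t * p
    multipleOfp d y 1≤d eq with (d + y) ℕ./ p | y ℕ./ p | m≡m%n+[m/n]*n (d + y) p | m≡m%n+[m/n]*n y p
    ... | a | b | ea | eb = quotient a b d≡
      where
      d≡ : d + b * p ≡ a * p
      d≡ = +-cancelˡ-≡ (y % p) _ _ (begin-equality
        y % p + (d + b * p)     ≡⟨ solve 3 (λ x y z → x :+ (y :+ z) := y :+ (x :+ z)) refl (y % p) d (b * p) ⟩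
        d + (y % p + b * p)     ≡⟨ cong (d +_) eb ⟨
        d + y                   ≡⟨ ea ⟩
        (d + y) % p + a * p     ≡⟨ cong (_+ a * p) eq ⟩
        y % p + a * p           ∎)
        where open +-*-Solver
      quotient : ∀ a b → d + b * p ≡ a * p → ∃[ t ] d ≡ 1+ t * p
      quotient a b eq′ with a ∸ b in a∸b
      ... | zero = ⊥-elim (<⇒≢ 1≤d (sym (d≡0
              (≤-trans (≤-reflexive eq′) (*-monoˡ-≤ p (m∸n≡0⇒m≤n {a} {b} a∸b))))))
        where
        d≡0 : d + b * p ≤ b * p → d ≡ 0
        d≡0 le = n≤0⇒n≡0 (+-cancelʳ-≤ (b * p) d 0 le)
      ... | 1+ t = t , (begin-equality
        d                    ≡⟨ m+n∸n≡m d (b * p) ⟨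
        d + b * p ∸ b * p    ≡⟨ cong (_∸ b * p) eq′ ⟩
        a * p ∸ b * p        ≡⟨ *-distribʳ-∸ p a b ⟨
        (a ∸ b) * p          ≡⟨ cong (_* p) a∸b ⟩
        1+ t * p             ∎)

    positive : ∀ y {a b} → a ≡ y + b → b < a → 1 ≤ y
    positive zero   refl b<b = ⊥-elim (<-irrefl refl b<b)
    positive (1+ y) _    _   = s≤s z≤n

    exchange : ∀ n → bound ≤ n → ∃[ z ] n ≡ p + z × T n ≤ T p + T z
    exchange n N≤n
      with i , j , i<j , eq ← Fin.pigeonhole (n<1+n p) (residue n)
      with x , nx , Tn ← subst (λ y → n ⊒ rest n y) (+-identityʳ (toℕ i)) (rest-⊒ n 0 (toℕ i))
      with d′ , j≡ ← (toℕ j ∸ 1+ (toℕ i) , trans (+-comm (1+ (toℕ j ∸ 1+ (toℕ i))) (toℕ i))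
                        (trans (+-suc (toℕ i) _) (m+[n∸m]≡n i<j)))
      with y , ry , Tr ← subst (λ z → rest n (toℕ i) ⊒ rest n z) j≡ (rest-⊒ n (toℕ i) (1+ d′))
      with t , refl ← multipleOfp y (rest n (toℕ j))
             (positive y ry (subst (λ z → rest n z < rest n (toℕ i)) j≡
                (rest-decreasing n (toℕ i) d′ N≤n
                  (subst (_≤ p) (sym j≡) (s≤s⁻¹ (Fin.toℕ<n j))))))
             (trans (cong (_% p) (sym ry)) (residue≡ n i j eq))
      = x + (t * p + rest n (toℕ j)) , total , (begin
          T n
            ≤⟨ Tn ⟩
          T x + T (rest n (toℕ i))
            ≤⟨ +-monoʳ-≤ (T x) Tr ⟩
          T x + (T (1+ t * p) + R)
            ≤⟨ +-monoʳ-≤ (T x) (+-monoˡ-≤ R block) ⟩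
          T x + (T p + T (t * p) + R)
            ≡⟨ solve 4 (λ a b c d → a :+ (b :+ c :+ d) := b :+ (a :+ (c :+ d))) refl
                 (T x) (T p) (T (t * p)) R ⟩
          T p + (T x + (T (t * p) + R))
            ≤⟨ +-monoʳ-≤ (T p) (+-monoʳ-≤ (T x) (super (t * p) (rest n (toℕ j)))) ⟩
          T p + (T x + T (t * p + rest n (toℕ j)))
            ≤⟨ +-monoʳ-≤ (T p) (super x _) ⟩
          T p + T (x + (t * p + rest n (toℕ j)))
            ∎)
      where
      open +-*-Solver
      R : ℕ
      R = T (rest n (toℕ j))
      block : T (1+ t * p) ≤ T p + T (t * p)
      block = ≤-trans
        (*-cancelʳ-≤ (T (1+ t * p)) (1+ t * T p) p (begin
          T (1+ t * p) * p   ≤⟨ ratio (1+ t * p) ⟩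
          1+ t * p * T p     ≡⟨ solve 3 (λ a b c → a :* b :* c := a :* c :* b) refl (1+ t) p (T p) ⟩
          1+ t * T p * p     ∎))
        (+-monoʳ-≤ (T p) (multiples t))
      total : n ≡ p + (x + (t * p + rest n (toℕ j)))
      total = trans nx (trans (cong (x +_) ry)
        (solve 4 (λ a b c d → a :+ (b :+ c :+ d) := b :+ (a :+ (c :+ d))) refl
          x p (t * p) (rest n (toℕ j))))

    periodic : ∀ n → bound ≤ n → T (p + n) ≤ T p + T n
    periodic n N≤n =
      let z , eq , le = exchange (p + n) (≤-trans N≤n (m≤n+m n p))
      in subst (λ x → T (p + n) ≤ T p + T x) (sym (+-cancelˡ-≡ p n z eq)) le

  eventuallyPeriodic : EventuallyPeriodic e
  eventuallyPeriodic =
    let j , _ , best = maxRatio k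
    in 1+ j , Exchange.bound j best , s≤s z≤n , Exchange.periodic j best

periodic-* : ∀ {e} → IsBinomid e → ∀ {p N} →
  (∀ n → N ≤ n → S e (p + n) ≤ S e p + S e n) →
  ∀ t n → N ≤ n → S e (t * p + n) ≤ S e (t * p) + S e n
periodic-* {e} be {p} {N} per t n N≤n =
  ≤-trans (upper t) (+-monoˡ-≤ (S e n) (lower t))
  where
  open ≤-Reasoning
  lower : ∀ t → t * S e p ≤ S e (t * p)
  lower zero   = z≤n
  lower (1+ t) =
    ≤-trans (+-monoʳ-≤ (S e p) (lower t)) (binomid⇒super be _ p (t * p) refl)
  upper : ∀ t → S e (t * p + n) ≤ t * S e p + S e n
  upper zero   = ≤-refl
  upper (1+ t) = begin
    S e (p + t * p + n)           ≡⟨ cong (S e) (+-assoc p (t * p) n) ⟩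
    S e (p + (t * p + n))         ≤⟨ per _ (≤-trans N≤n (m≤n+m n (t * p))) ⟩
    S e p + S e (t * p + n)       ≤⟨ +-monoʳ-≤ (S e p) (upper t) ⟩
    S e p + (t * S e p + S e n)   ≡⟨ +-assoc (S e p) _ _ ⟨
    1+ t * S e p + S e n          ∎

+-isBinomid : ∀ {e f} → IsBinomid e → IsBinomid f → IsBinomid (λ i → e i + f i)
+-isBinomid {e} {f} be bf = super⇒binomid λ { n a b refl → begin
  S g a + S g b                         ≡⟨ cong₂ _+_ (S-distrib e f a) (S-distrib e f b) ⟩
  (S e a + S f a) + (S e b + S f b)     ≡⟨ solve 4 (λ a b c d → (a :+ b) :+ (c :+ d) := (a :+ c) :+ (b :+ d))
                                             refl (S e a) (S f a) (S e b) (S f b) ⟩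
  (S e a + S e b) + (S f a + S f b)     ≤⟨ +-mono-≤ (binomid⇒super be _ a b refl)
                                                    (binomid⇒super bf _ a b refl) ⟩
  S e (a + b) + S f (a + b)             ≡⟨ S-distrib e f (a + b) ⟨
  S g (a + b)                           ∎ }
  where
  open ≤-Reasoning
  open +-*-Solver
  g : Seq
  g i = e i + f i

+-splits : ∀ {e f} → IsBinomid e → IsBinomid f →
           EventuallyPeriodic e → EventuallyPeriodic f →
           ∃[ k ] Splits (λ i → e i + f i) (1+ k)
+-splits {e} {f} be bf (p , M , 1≤p , pe) (q , N , 1≤q , pf) = P + (M + N) , split
  where
  open ≤-Reasoning
  g : Seq
  g i = e i + f i
  P : ℕ
  P = p * q
  rearrange : ∀ a b c d → (a + b) + (c + d) ≡ (a + c) + (b + d)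
  rearrange = solve 4 (λ a b c d → (a :+ b) :+ (c :+ d) := (a :+ c) :+ (b :+ d)) refl
    where open +-*-Solver
  upper : ∀ n → M + N ≤ n → S g (P + n) ≤ S g P + S g n
  upper n le = begin
    S g (P + n)                         ≡⟨ S-distrib e f (P + n) ⟩
    S e (P + n) + S f (P + n)           ≤⟨ +-mono-≤
      (subst (λ x → S e (x + n) ≤ S e x + S e n) (*-comm q p)
        (periodic-* be pe q n (≤-trans (m≤m+n M N) le)))
      (periodic-* bf pf p n (≤-trans (m≤n+m N M) le)) ⟩
    (S e P + S e n) + (S f P + S f n)   ≡⟨ rearrange (S e P) _ _ _ ⟩
    (S e P + S f P) + (S e n + S f n)   ≡⟨ cong₂ _+_ (S-distrib e f P) (S-distrib e f n) ⟨
    S g P + S g n                       ∎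
  split : Splits g (1+ (P + (M + N)))
  split n lt = P , n ∸ P , *-mono-≤ 1≤p 1≤q ,
    ≤-trans (s≤s z≤n) MN< , m+[n∸m]≡n P≤n ,
    ≤-antisym
      (subst (λ x → S g x ≤ S g P + S g (n ∸ P)) (m+[n∸m]≡n P≤n)
        (upper (n ∸ P) (<⇒≤ MN<)))
      (binomid⇒super (+-isBinomid be bf) n P (n ∸ P) (m+[n∸m]≡n P≤n))
    where
    P+MN≤n : P + 1+ (M + N) ≤ n
    P+MN≤n = ≤-trans (≤-reflexive (+-suc P (M + N))) (<⇒≤ lt)
    P≤n : P ≤ n
    P≤n = ≤-trans (m≤m+n P _) P+MN≤n
    MN< : M + N < n ∸ P
    MN< = m+n≤o⇒m≤o∸n _ (≤-trans (≤-reflexive (+-comm (1+ (M + N)) P)) P+MN≤n)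

0-isBinomid : IsBinomid (λ _ → 0)
0-isBinomid k n _ _ = ≤-refl

0-isLexMinimal : IsLexMinimal (λ _ → 0)
0-isLexMinimal = 0 , (prefix 1 (λ _ → 0) , prefix-binomid 1 0-isBinomid) ,
  record
    { isBinomid = 0-isBinomid
    ; extends   = prefix-extends 1 (λ _ → 0)
    ; minimal   = λ { _ _ _ (_ , _ , ()) }
    }

+-isLexMinimal : ∀ {e f} → IsLexMinimal e → IsLexMinimal f → IsLexMinimal (λ i → e i + f i)
+-isLexMinimal {e} {f} (k , η , me) (l , θ , mf) =
  let be = IsLexMinExtension.isBinomid me
      bf = IsLexMinExtension.isBinomid mf
      bg = +-isBinomid be bf
      n , spl = +-splits be bf
        (Periodicity.eventuallyPeriodic be k (lexMin⇒splits η me))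
        (Periodicity.eventuallyPeriodic bf l (lexMin⇒splits θ mf))
  in n , (prefix (1+ n) (λ i → e i + f i) , prefix-binomid (1+ n) bg) , splits⇒lexMin (1+ n) bg spl

𝕀 : CommutativeMonoid 0ℓ 0ℓ
𝕀 = subMonoid (Pointwise.commutativeMonoid ℕ +-0-commutativeMonoid)
      IsBinomid 0-isBinomid +-isBinomid

𝕃 : CommutativeMonoid 0ℓ 0ℓ
𝕃 = subMonoid 𝕀 (IsLexMinimal ∘ proj₁) 0-isLexMinimal +-isLexMinimal

module 𝕀 = CommutativeMonoid 𝕀
module 𝕃 = CommutativeMonoid 𝕃

-- Both L k and its image Lₖ𝕀ₖ k concern indices of length k + 1, so that
-- k : ℕ runs through all lengths ≥ 1.

L : ∀ k → 𝕀[ 1+ k ] → 𝕃.Carrier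
L k η = let ζ , mζ = lexMinExtension η
        in (ζ , IsLexMinExtension.isBinomid mζ) , k , η , mζ

Lₖ𝕀ₖ : ℕ → Pred 𝕃.Carrier 0ℓ
Lₖ𝕀ₖ k ζ = ∃[ η ] ζ 𝕃.≈ L k η

Atomic : Pred 𝕀.Carrier 0ℓ
Atomic η = ¬ (∃₂ λ η₁ η₂ → ¬ (η₁ 𝕀.≈ 𝕀.ε) × ¬ (η₂ 𝕀.≈ 𝕀.ε) × η 𝕀.≈ η₁ 𝕀.∙ η₂)

Atom : Pred 𝕀.Carrier 0ℓ
Atom η = ¬ (η 𝕀.≈ 𝕀.ε) × Atomic η

Atom∩Lₖ𝕀ₖ : ℕ → Pred 𝕃.Carrier 0ℓ
Atom∩Lₖ𝕀ₖ k ζ = Atom (proj₁ ζ) × Lₖ𝕀ₖ k ζ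

{-# OPTIONS --safe #-}
module Submission where

-- Let m be the length of the finite indices.  Every lex-minimal extension has
-- a period dividing m !, with a preperiod depending on m only, so it is a
-- vector of fixed length.  Fixing for each n > m a summand at which S attains
-- superadditivity cuts the extensions into finitely many sets of solutions of
-- homogeneous linear inequalities, each finitely generated by Gordan's lemma.
-- The relations among the generators form the solution set of linear
-- equations, so Gordan's lemma makes them finitely generated as well.  A sum of
-- two binomid indices attains superadditivity only where both summands do;
-- hence the factors of a lex-minimal extension are again such extensions of the
-- same length, and a factorisation with the most factors consists of atoms.

open import Defs
open import Level using (Level)
open import Algebra.Bundles using (CommutativeMonoid; Monoid)
open import Algebra.Morphism.Bundles using (MonoidHomomorphism)
open import Data.Bool using (if_then_else_)
open import Data.Empty using (⊥-elim)
open import Data.Fin as Fin using (Fin; toℕ; fromℕ<)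
import Data.Fin.Properties as Fin
open import Data.List
  using (List; []; _∷_; [_]; _++_; map; mapMaybe; concat; length; lookup; filter; take; drop;
         cartesianProductWith; allFin; upTo; applyUpTo; replicate)
open import Data.List.Membership.Propositional using (_∈_; find; lose)
open import Data.List.Membership.Propositional.Properties
open import Data.List.Properties
  using (map-++; ++-assoc; ++-identityʳ; concat-map-[_]; concat-concat; take++drop≡id;
         length-take; length-drop; length-++; mapMaybe-++; mapMaybeIsInj₁∘mapInj₁;
         mapMaybeIsInj₁∘mapInj₂; mapMaybeIsInj₂∘mapInj₁; mapMaybeIsInj₂∘mapInj₂)
open import Data.List.Relation.Binary.Permutation.Propositional
  using (_↭_; prep; swap; ↭-refl; ↭-reflexive; ↭-sym; ↭-trans) renaming (refl to refl↭; trans to trans↭)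
open import Data.List.Relation.Binary.Permutation.Propositional.Properties
  using (map⁺; shift; shifts; ++⁺ˡ; All-resp-↭; ↭-length; mapMaybe-↭)
open import Data.List.Relation.Unary.All as All using (All; []; _∷_)
import Data.List.Relation.Unary.All.Properties as All
open import Data.List.Relation.Unary.Any as Any using (Any; here; there; index)
import Data.List.Relation.Unary.Any.Properties as Any
open import Data.Nat
open import Data.Nat.Divisibility using (divides; ∣-trans; m∣m*n; m≤n⇒m!∣n!)
open import Data.Nat.DivMod using (_%_; m%n<n; m<n⇒m%n≡m; [m+n]%n≡m%n)
open import Data.Nat.Induction using (<-rec)
open import Data.Nat.ListAction using (sum)
open import Data.Nat.ListAction.Properties using (sum-++; sum-↭)
open import Data.Nat.Properties
open import Data.Nat.Solver using (module +-*-Solver)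
open import Data.Product using (Σ-syntax; ∃; ∃₂; ∃-syntax; _×_; _,_; proj₁; proj₂)
open import Data.Sum as Sum using (_⊎_; inj₁; inj₂; isInj₁; isInj₂)
open import Function using (_∘_; const)
open import Relation.Binary.PropositionalEquality
  hiding ([_])
open import Relation.Nullary using (¬_; Dec; yes; no; does)
open import Relation.Nullary.Decidable using (dec-true; dec-false; _×-dec_)
open import Relation.Unary using (Pred; _⊆_; _≐_)
open Generated 𝕃 using (⟨_⟩; ⟨_⟩ᴹ; ⟨⟩-closed; product; product-++)

-- Gordan's lemma

private
  variable
    a : Level
    X : Set a

weight : (X → ℕ) → List X → ℕ
weight f w = sum (map f w)

weight-++ : ∀ (f : X → ℕ) v w → weight f (v ++ w) ≡ weight f v + weight f w
weight-++ f v w = trans (cong sum (map-++ f v w)) (sum-++ (map f v) (map f w))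

weight-↭ : ∀ (f : X → ℕ) {v w} → v ↭ w → weight f v ≡ weight f w
weight-↭ f p = sum-↭ (map⁺ f p)

weight-concat : ∀ (f : X → ℕ) vs → weight f (concat vs) ≡ weight (weight f) vs
weight-concat f []       = refl
weight-concat f (v ∷ vs) =
  trans (weight-++ f v (concat vs)) (cong (weight f v +_) (weight-concat f vs))

weight-+ : ∀ (f g : X → ℕ) w → weight (λ x → f x + g x) w ≡ weight f w + weight g w
weight-+ f g []      = refl
weight-+ f g (x ∷ w) = trans (cong (f x + g x +_) (weight-+ f g w))
  (solve 4 (λ a b c d → a :+ b :+ (c :+ d) := (a :+ c) :+ (b :+ d)) refl
    (f x) (g x) (weight f w) (weight g w))
  where open +-*-Solver

weight-mono : ∀ {f g : X → ℕ} {w} → All (λ x → f x ≤ g x) w → weight f w ≤ weight g w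
weight-mono []       = z≤n
weight-mono (p ∷ ps) = +-mono-≤ p (weight-mono ps)

concat-↭ : {vs ws : List (List X)} → vs ↭ ws → concat vs ↭ concat ws
concat-↭ refl↭                = ↭-refl
concat-↭ (prep v p)           = ++⁺ˡ v (concat-↭ p)
concat-↭ (swap v w p)        =
  ↭-trans (shifts v w) (++⁺ˡ w (++⁺ˡ v (concat-↭ p)))
concat-↭ (trans↭ p q)         = ↭-trans (concat-↭ p) (concat-↭ q)

wordsUpTo : List X → ℕ → List (List X)
wordsUpTo xs zero    = [ [] ]
wordsUpTo xs (suc n) = [] ∷ cartesianProductWith _∷_ xs (wordsUpTo xs n)

∈-wordsUpTo⁺ : ∀ {xs : List X} {n w} → All (_∈ xs) w → length w ≤ n → w ∈ wordsUpTo xs n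
∈-wordsUpTo⁺ {n = zero}  []       _         = here refl
∈-wordsUpTo⁺ {n = suc n} []       _         = here refl
∈-wordsUpTo⁺ {n = suc n} (p ∷ ps) (s≤s len) =
  there (∈-cartesianProductWith⁺ _∷_ p (∈-wordsUpTo⁺ ps len))

∈-wordsUpTo⁻ : ∀ (xs : List X) n {w} → w ∈ wordsUpTo xs n → All (_∈ xs) w
∈-wordsUpTo⁻ xs zero    (here refl) = []
∈-wordsUpTo⁻ xs (suc n) (here refl) = []
∈-wordsUpTo⁻ xs (suc n) (there w∈)
  with _ , _ , x∈ , v∈ , refl ← ∈-cartesianProductWith⁻ _∷_ xs (wordsUpTo xs n) w∈ =
  x∈ ∷ ∈-wordsUpTo⁻ xs n v∈

-- A homogeneous linear inequality whose unknowns are the letter multiplicities of a word. The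
-- integer coefficient of `x` is `g x − f x`; keeping two functions avoids subtraction.
Constraint : Set a → Set a
Constraint X = (X → ℕ) × (X → ℕ)

infix 4 _⊨_
_⊨_ : List X → Constraint X → Set
w ⊨ (f , g) = weight f w ≤ weight g w

⊨-concat : ∀ (d : Constraint X) {vs} → All (_⊨ d) vs → concat vs ⊨ d
⊨-concat (f , g) {vs} sat = subst₂ _≤_
  (sym (weight-concat f vs)) (sym (weight-concat g vs)) (weight-mono sat)

⊨-↭ : ∀ (d : Constraint X) {v w} → v ↭ w → v ⊨ d → w ⊨ d
⊨-↭ (f , g) p = subst₂ _≤_ (weight-↭ f p) (weight-↭ g p)

-- Reading the letters of w in a suitable order keeps the running value of
-- g − f, started at B, inside [0 , 2B).  After 2B letters a value repeats,
-- and the letters read in between form a factor on which f and g agree.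

module Peel {X : Set a} (f g : X → ℕ) (gens : List X) (B : ℕ) (1≤B : 1 ≤ B)
            (bound : ∀ {x} → x ∈ gens → f x ≤ B × g x ≤ B) where
  open ≤-Reasoning

  M : ℕ
  M = B + B

  Peelable : List X → Set a
  Peelable w = ∃₂ λ v w′ → w ↭ v ++ w′ × 1 ≤ length v × length v ≤ M ×
                           v ⊨ (f , g) × w′ ⊨ (f , g)

  -- The letters read so far stand latest first, and the index is the current value. The equation in
  -- `step` says `s′ = s + g x − f x` without truncated subtraction.
  data Trace : ℕ → List X → Set a where
    []   : Trace B []
    step : ∀ {s s′ x q} → s + g x ≡ s′ + f x → s′ < M → Trace s q → Trace s′ (x ∷ q)

  B<M : B < M
  B<M = m<m+n B 1≤B

  -- Counts backwards from the current value. Past the first letter it stays at the starting value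
  -- `B`, which keeps `state-balance` true where `take` and `drop` have run out of letters.
  state : ∀ {s q} → Trace s q → ℕ → ℕ
  state {s} tr        zero    = s
  state [] (suc i)            = B
  state (step _ _ tr) (suc i) = state tr i

  state<M : ∀ {s q} (tr : Trace s q) i → state tr i < M
  state<M []             zero    = B<M
  state<M (step _ s<M _) zero    = s<M
  state<M []             (suc i) = B<M
  state<M (step _ _ tr)  (suc i) = state<M tr i

  state-balance : ∀ {s q} (tr : Trace s q) i d →
    state tr (i + d) + weight g (take d (drop i q)) ≡ state tr i + weight f (take d (drop i q))
  state-balance tr            zero    zero    = refl
  state-balance []            zero    (suc d) = refl
  state-balance {s} {x ∷ q} (step {s₀} eq _ tr) zero (suc d) = begin-equality
    s′ + (g x + G)  ≡⟨ solve 3 (λ a b c → a :+ (b :+ c) := b :+ (a :+ c)) refl s′ (g x) G ⟩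
    g x + (s′ + G)  ≡⟨ cong (g x +_) (state-balance tr zero d) ⟩
    g x + (s₀ + F)  ≡⟨ solve 3 (λ a b c → a :+ (b :+ c) := (b :+ a) :+ c) refl (g x) s₀ F ⟩
    (s₀ + g x) + F  ≡⟨ cong (_+ F) eq ⟩
    (s + f x) + F   ≡⟨ +-assoc s (f x) F ⟩
    s + (f x + F)   ∎
    where
    open +-*-Solver
    s′ F G : ℕ
    s′ = state tr d
    F = weight f (take d q)
    G = weight g (take d q)
  state-balance []            (suc i) zero    = refl
  state-balance []            (suc i) (suc d) = refl
  state-balance (step _ _ tr) (suc i) d       = state-balance tr i d

  trace-total : ∀ {s q} → Trace s q → B + weight g q ≡ s + weight f q
  trace-total []                                = refl
  trace-total {s} {x ∷ q} (step {s₀} eq _ tr) = begin-equality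
    B + (g x + G)  ≡⟨ solve 3 (λ a b c → a :+ (b :+ c) := b :+ (a :+ c)) refl B (g x) G ⟩
    g x + (B + G)  ≡⟨ cong (g x +_) (trace-total tr) ⟩
    g x + (s₀ + F) ≡⟨ solve 3 (λ a b c → a :+ (b :+ c) := (b :+ a) :+ c) refl (g x) s₀ F ⟩
    (s₀ + g x) + F ≡⟨ cong (_+ F) eq ⟩
    (s + f x) + F  ≡⟨ +-assoc s (f x) F ⟩
    s + (f x + F)  ∎
    where
    open +-*-Solver
    F G : ℕ
    F = weight f q
    G = weight g q

  balancedFactor : ∀ {s q} → Trace s q → M ≤ length q →
    ∃₂ λ u v → ∃[ u′ ] q ≡ u ++ v ++ u′ × 1 ≤ length v × weight g v ≡ weight f v
  balancedFactor {q = q} tr M≤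
    with i , j , i<j , eq ← Fin.pigeonhole (n<1+n M) (λ i → fromℕ< (state<M tr (toℕ i)))
    = take i′ q , v , drop d q′ , split , long , balanced
    where
    i′ d : ℕ
    i′ = toℕ i
    d = toℕ j ∸ i′
    q′ v : List X
    q′ = drop i′ q
    v = take d q′
    split : q ≡ take i′ q ++ v ++ drop d q′
    split = sym (trans (cong (take i′ q ++_) (take++drop≡id d q′)) (take++drop≡id i′ q))
    long : 1 ≤ length v
    long = begin
      1                    ≤⟨ ⊓-glb (m<n⇒0<n∸m i<j)
                                (m<n⇒0<n∸m (<-≤-trans (<-≤-trans i<j (s≤s⁻¹ (Fin.toℕ<n j))) M≤)) ⟩
      d ⊓ (length q ∸ i′)  ≡⟨ cong (d ⊓_) (length-drop i′ q) ⟨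
      d ⊓ length q′        ≡⟨ length-take d q′ ⟨
      length v             ∎
    same : state tr (toℕ i) ≡ state tr (toℕ j)
    same = trans (sym (Fin.toℕ-fromℕ< _)) (trans (cong toℕ eq) (Fin.toℕ-fromℕ< _))
    balanced : weight g v ≡ weight f v
    balanced = +-cancelˡ-≡ (state tr i′) _ _ (begin-equality
      state tr i′ + weight g v        ≡⟨ cong (_+ weight g v) same ⟩
      state tr (toℕ j) + weight g v   ≡⟨ cong (λ n → state tr n + weight g v) (m+[n∸m]≡n (<⇒≤ i<j)) ⟨
      state tr (i′ + d) + weight g v  ≡⟨ state-balance tr i′ d ⟩
      state tr i′ + weight f v        ∎)

  extract : ∀ {w} q {r} → w ↭ q ++ r → ∀ {x} → x ∈ r →
            Σ[ r′ ∈ List X ] r ↭ x ∷ r′ × w ↭ (x ∷ q) ++ r′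
  extract q p {x} x∈r with ys , zs , refl ← ∈-∃++ x∈r =
    ys ++ zs , shift x ys zs ,
    ↭-trans p (↭-trans (++⁺ˡ q (shift x ys zs)) (shift x q (ys ++ zs)))

  -- Recursion on the number `n` of letters still to be read, with `q` read and `r` unread. Below
  -- `B` some unread letter has `f x < g x`, since otherwise `w ⊨ (f , g)` would force `B ≤ s`. From
  -- `B` on, a letter with `g x ≤ f x` is read. As both weights of a letter are at most `B`, the
  -- value stays in range.
  walk : ∀ n {s w q r} → Trace s q → length q + n ≡ M → w ↭ q ++ r → All (_∈ gens) r →
         1 ≤ length w → w ⊨ (f , g) → Peelable w
  walk zero {s} {w} {q} {r} tr len w↭ _ _ w⊨
    with u , v , u′ , refl , 1≤v , gv≡fv ←
           balancedFactor tr (≤-reflexive (trans (sym len) (+-identityʳ _))) =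
    v , u ++ u′ ++ r , w↭′ , 1≤v , v≤M , ≤-reflexive (sym gv≡fv) ,
    -- Cutting out a balanced factor lowers both sides of the inequality equally.
    +-cancelˡ-≤ (weight f v) _ _ (begin
      weight f v + weight f (u ++ u′ ++ r)  ≡⟨ weight-++ f v _ ⟨
      weight f (v ++ u ++ u′ ++ r)          ≤⟨ ⊨-↭ (f , g) w↭′ w⊨ ⟩
      weight g (v ++ u ++ u′ ++ r)          ≡⟨ weight-++ g v _ ⟩
      weight g v + weight g (u ++ u′ ++ r)  ≡⟨ cong (_+ weight g (u ++ u′ ++ r)) gv≡fv ⟩
      weight f v + weight g (u ++ u′ ++ r)  ∎)
    where
    w↭′ : w ↭ v ++ u ++ u′ ++ r
    w↭′ = ↭-trans w↭ (↭-trans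
      (↭-reflexive (trans (++-assoc u (v ++ u′) r) (cong (u ++_) (++-assoc v u′ r))))
      (shifts u v))
    v≤M : length v ≤ M
    v≤M = begin
      length v                           ≤⟨ m≤m+n _ (length u′) ⟩
      length v + length u′               ≡⟨ length-++ v ⟨
      length (v ++ u′)                   ≤⟨ m≤n+m _ (length u) ⟩
      length u + length (v ++ u′)        ≡⟨ length-++ u ⟨
      length (u ++ v ++ u′)              ≡⟨ +-identityʳ _ ⟨
      length (u ++ v ++ u′) + 0          ≡⟨ len ⟩
      M                                  ∎
  walk (suc n) {s} {w} {q} {r} tr len w↭ bd 1≤w w⊨ with s <? B
  ... | yes s<B with Any.any? (λ x → f x <? g x) r
  ...   | yes pos with x , x∈r , fx<gx ← find pos
                  with r′ , r↭ , w↭′ ← extract q w↭ x∈r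
                  with x∈ ∷ bd′ ← All-resp-↭ r↭ bd =
    walk n (step (sym (m∸n+n≡m fx≤)) s′<M tr)
      (trans (sym (+-suc _ n)) len) w↭′ bd′ 1≤w w⊨
    where
    fx≤ : f x ≤ s + g x
    fx≤ = ≤-trans (<⇒≤ fx<gx) (m≤n+m (g x) s)
    s′<M : s + g x ∸ f x < M
    s′<M = ≤-<-trans (m∸n≤m _ (f x)) (+-mono-<-≤ s<B (proj₂ (bound x∈)))
  ...   | no none = ⊥-elim (<⇒≱ s<B (+-cancelʳ-≤ (weight g q) B s (begin
      B + weight g q  ≡⟨ trace-total tr ⟩
      s + weight f q  ≤⟨ +-monoʳ-≤ s (+-cancelʳ-≤ (weight f r) _ _ (begin
        weight f q + weight f r  ≡⟨ weight-++ f q r ⟨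
        weight f (q ++ r)        ≤⟨ ⊨-↭ (f , g) w↭ w⊨ ⟩
        weight g (q ++ r)        ≡⟨ weight-++ g q r ⟩
        weight g q + weight g r  ≤⟨ +-monoʳ-≤ (weight g q)
                                      (weight-mono (All.map ≮⇒≥ (All.¬Any⇒All¬ r none))) ⟩
        weight g q + weight f r  ∎)) ⟩
      s + weight g q  ∎)))
  walk (suc n) {s} {w} {q} {r} tr len w↭ bd 1≤w w⊨
      | no s≮B with Any.any? (λ x → g x ≤? f x) r
  ...   | yes neg with x , x∈r , gx≤fx ← find neg
                  with r′ , r↭ , w↭′ ← extract q w↭ x∈r
                  with x∈ ∷ bd′ ← All-resp-↭ r↭ bd =
    walk n (step (sym (m∸n+n≡m (≤-trans fx≤s (m≤m+n s (g x))))) s′<M tr)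
      (trans (sym (+-suc _ n)) len) w↭′ bd′ 1≤w w⊨
    where
    fx≤s : f x ≤ s
    fx≤s = ≤-trans (proj₁ (bound x∈)) (≮⇒≥ s≮B)
    s′<M : s + g x ∸ f x < M
    s′<M = ≤-<-trans (m≤n+o⇒m∸n≤o _ (f x)
      (≤-trans (+-monoʳ-≤ s gx≤fx) (≤-reflexive (+-comm s (f x))))) (state<M tr 0)
  ...   | no none with r | All.¬Any⇒All¬ r none
  -- All letters were read before the limit `M`, so `w` is short enough to be the piece itself.
  ...     | []     | _ = w , [] , ↭-reflexive (sym (++-identityʳ w)) , 1≤w , w≤M , w⊨ , z≤n
    where
    w≤M : length w ≤ M
    w≤M = begin
      length w            ≡⟨ ↭-length w↭ ⟩
      length (q ++ [])    ≡⟨ cong length (++-identityʳ q) ⟩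
      length q            ≤⟨ m≤m+n _ (suc n) ⟩
      length q + suc n    ≡⟨ len ⟩
      M                   ∎
  -- Every unread letter has `f < g`, so `y` alone is a piece. The rest still satisfies the
  -- inequality, because `B ≤ s` gives it on `q`.
  ...     | y ∷ r′ | y+ ∷ r+ =
    [ y ] , q ++ r′ , ↭-trans w↭ (shift y q r′) , ≤-refl , ≤-trans 1≤B (<⇒≤ B<M) ,
    +-monoˡ-≤ 0 (<⇒≤ (≰⇒> y+)) , (begin
      weight f (q ++ r′)       ≡⟨ weight-++ f q r′ ⟩
      weight f q + weight f r′ ≤⟨ +-mono-≤ fq≤gq (weight-mono (All.map (<⇒≤ ∘ ≰⇒>) r+)) ⟩
      weight g q + weight g r′ ≡⟨ weight-++ g q r′ ⟨
      weight g (q ++ r′)       ∎)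
    where
    fq≤gq : weight f q ≤ weight g q
    fq≤gq = +-cancelˡ-≤ B _ _ (begin
      B + weight f q  ≤⟨ +-monoˡ-≤ _ (≮⇒≥ s≮B) ⟩
      s + weight f q  ≡⟨ trace-total tr ⟨
      B + weight g q  ∎)

  peel : ∀ {w} → All (_∈ gens) w → 1 ≤ length w → w ⊨ (f , g) → Peelable w
  peel bd = walk M [] refl ↭-refl bd

  Short : List X → Set a
  Short v = All (_∈ gens) v × length v ≤ M × v ⊨ (f , g)

  decompose : ∀ n w → length w ≤ n → All (_∈ gens) w → w ⊨ (f , g) →
              ∃[ vs ] All Short vs × w ↭ concat vs
  decompose _       []        _   _  _  = [] , [] , ↭-refl
  decompose (suc n) w@(_ ∷ _) len bd w⊨
    with v , w′ , w↭ , 1≤v , v≤M , v⊨ , w′⊨ ← peel bd (s≤s z≤n) w⊨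
    with bdᵥ , bd′ ← All.++⁻ v (All-resp-↭ w↭ bd)
    with vs , short , w′↭ ← decompose n w′
           (s≤s⁻¹ (begin
             suc (length w′)       ≤⟨ +-monoˡ-≤ _ 1≤v ⟩
             length v + length w′  ≡⟨ length-++ v ⟨
             length (v ++ w′)      ≡⟨ ↭-length w↭ ⟨
             length w              ≤⟨ len ⟩
             suc n                 ∎)) bd′ w′⊨ =
    v ∷ vs , (bdᵥ , v≤M , v⊨) ∷ short , ↭-trans w↭ (++⁺ˡ v w′↭)

maxWeight : (X → ℕ) → List X → ℕ
maxWeight f []       = 0
maxWeight f (x ∷ xs) = f x ⊔ maxWeight f xs

≤maxWeight : ∀ (f : X → ℕ) {x xs} → x ∈ xs → f x ≤ maxWeight f xs
≤maxWeight f (here refl) = m≤m⊔n (f _) _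
≤maxWeight f (there x∈xs)  = ≤-trans (≤maxWeight f x∈xs) (m≤n⊔m (f _) _)

-- Up to the order of letters a word is a vector over ℕ, and concatenation is addition. The words in
-- `Ws` lie in `P`, while their concatenations may leave it when `P` is a union of submonoids.
FiniteBasis : {X : Set a} → List X → (List X → Set) → Set a
FiniteBasis {X = X} gens P = Σ[ Ws ∈ List (List X) ] All (λ W → All (_∈ gens) W × P W) Ws ×
  (∀ w → All (_∈ gens) w → P w → ∃[ vs ] All (_∈ Ws) vs × w ↭ concat vs)

-- Repeated peeling leaves only pieces of length at most `M`, and there are finitely many words of
-- that length over `gens`.
gordan₁ : ∀ (gens : List X) d → FiniteBasis gens (_⊨ d)
gordan₁ {X = X} gens (f , g) = filter ⊨? words , sound , complete
  where
  B : ℕ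
  -- The successor makes `B` positive even if all weights vanish.
  B = suc (maxWeight f gens ⊔ maxWeight g gens)
  open Peel f g gens B (s≤s z≤n) (λ x∈ →
    m≤n⇒m≤1+n (≤-trans (≤maxWeight f x∈) (m≤m⊔n _ _)) ,
    m≤n⇒m≤1+n (≤-trans (≤maxWeight g x∈) (m≤n⊔m (maxWeight f gens) _)))
  words : List (List X)
  words = wordsUpTo gens M
  ⊨? : ∀ w → Dec (w ⊨ (f , g))
  ⊨? w = weight f w ≤? weight g w
  sound : All (λ W → All (_∈ gens) W × W ⊨ (f , g)) (filter ⊨? words)
  sound = All.tabulate λ W∈ → let W∈′ , W⊨ = ∈-filter⁻ ⊨? W∈ in ∈-wordsUpTo⁻ gens M W∈′ , W⊨
  complete : ∀ w → All (_∈ gens) w → w ⊨ (f , g) →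
             ∃[ vs ] All (_∈ filter ⊨? words) vs × w ↭ concat vs
  complete w w∈ w⊨ =
    let vs , short , w↭ = decompose (length w) w ≤-refl w∈ w⊨
    in vs , All.map (λ (v∈ , v≤M , v⊨) → ∈-filter⁺ ⊨? (∈-wordsUpTo⁺ v∈ v≤M) v⊨) short , w↭

unconcat : ∀ {Vs : List (List (List X))} {ws} → All (_∈ map concat Vs) ws →
           ∃[ vs ] All (_∈ Vs) vs × ws ≡ map concat vs
unconcat []         = [] , [] , refl
unconcat (w∈ ∷ ws∈)
  with v , v∈ , refl ← ∈-map⁻ concat w∈
     | vs , vs∈ , refl ← unconcat ws∈ = v ∷ vs , v∈ ∷ vs∈ , refl

-- Induction on the number of inequalities: the basis words for `ds` serve as the letters of a new
-- alphabet, on which `d` is again a single inequality, with the weights of whole words as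
-- coefficients.
gordan : ∀ (gens : List X) ds → FiniteBasis gens (λ w → All (w ⊨_) ds)
gordan gens [] = map [_] gens ,
  All.map⁺ (All.tabulate λ x∈ → (x∈ ∷ []) , []) ,
  λ w w∈ _ → map [_] w , All.map⁺ (All.map (∈-map⁺ [_]) w∈) , ↭-reflexive (sym (concat-map-[ w ]))
gordan {X = X} gens (d@(f , g) ∷ ds)
  with Ws , soundW , completeW ← gordan gens ds
  with Vs , soundV , completeV ← gordan₁ Ws (weight f , weight g) =
  map concat Vs , All.map⁺ (All.map sound soundV) , complete
  where
  sound : ∀ {V} → All (_∈ Ws) V × V ⊨ (weight f , weight g) →
          All (_∈ gens) (concat V) × All (concat V ⊨_) (d ∷ ds)
  sound {V} (V∈ , V⊨) =
    All.concat⁺ (All.map (proj₁ ∘ All.lookup soundW) V∈) ,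
    subst₂ _≤_ (sym (weight-concat f V)) (sym (weight-concat g V)) V⊨ ∷
    All.tabulate λ {d′} d′∈ →
      ⊨-concat d′ (All.map (λ v∈ → All.lookup (proj₂ (All.lookup soundW v∈)) d′∈) V∈)
  complete : ∀ w → All (_∈ gens) w → All (w ⊨_) (d ∷ ds) →
             ∃[ vs ] All (_∈ map concat Vs) vs × w ↭ concat vs
  complete w w∈ (w⊨ ∷ w⊨s) =
    let ws , ws∈ , w↭ = completeW w w∈ w⊨s
        vs , vs∈ , ws↭ = completeV ws ws∈
          (subst₂ _≤_ (weight-concat f ws) (weight-concat g ws) (⊨-↭ d w↭ w⊨))
    in map concat vs , All.map⁺ (All.map (∈-map⁺ concat) vs∈) ,
       ↭-trans w↭ (↭-trans (concat-↭ ws↭) (↭-reflexive (sym (concat-concat vs))))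

-- The words satisfying a disjunctive system form a finite union of the
-- submonoids treated by gordan, not a submonoid themselves.

gordanAny : ∀ (gens : List X) (ds : List (Constraint X)) dss →
            FiniteBasis gens (λ w → All (w ⊨_) ds × All (Any (w ⊨_)) dss)
gordanAny gens ds [] =
  let Ws , sound , complete = gordan gens ds
  in Ws , All.map (λ (W∈ , W⊨) → W∈ , W⊨ , []) sound , λ w w∈ (w⊨ , _) → complete w w∈ w⊨
gordanAny {X = X} gens ds (es ∷ dss) = branches es
  where
  branches : ∀ es → FiniteBasis gens (λ w → All (w ⊨_) ds × All (Any (w ⊨_)) (es ∷ dss))
  branches [] = [] , [] , λ { _ _ (_ , () ∷ _) }
  branches (e ∷ es)
    with Ws , soundW , completeW ← gordanAny gens (e ∷ ds) dss
       | Vs , soundV , completeV ← branches es =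
    Ws ++ Vs ,
    All.++⁺
      (All.map (λ { (W∈ , W⊨ ∷ W⊨s , W⊨ss) → W∈ , W⊨s , here W⊨ ∷ W⊨ss }) soundW)
      (All.map (λ { (V∈ , V⊨s , V⊨ ∷ V⊨ss) → V∈ , V⊨s , there V⊨ ∷ V⊨ss }) soundV) ,
    λ { w w∈ (w⊨s , here w⊨ ∷ w⊨ss) →
          let vs , vs∈ , w↭ = completeW w w∈ (w⊨ ∷ w⊨s , w⊨ss)
          in vs , All.map ∈-++⁺ˡ vs∈ , w↭
      ; w w∈ (w⊨s , there w⊨ ∷ w⊨ss) →
          let vs , vs∈ , w↭ = completeV w w∈ (w⊨s , w⊨ ∷ w⊨ss)
          in vs , All.map (∈-++⁺ʳ Ws) vs∈ , w↭ }

-- Finite presentations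

module Presentation {a ℓ : Level} (M : CommutativeMonoid a ℓ) where
  open CommutativeMonoid M
    renaming (refl to ≈-refl; sym to ≈-sym; trans to ≈-trans; reflexive to ≈-reflexive)
  open Generated M using () renaming (product to ∏; product-++ to ∏-++)

  module _ (gs : List Carrier) where
    private
      n : ℕ
      n = length gs

      Letter : Set
      Letter = Fin n ⊎ Fin n

    value : Word n → Carrier
    value w = ∏ (map (lookup gs) w)

    value-++ : ∀ u v → value (u ++ v) ≈ value u ∙ value v
    value-++ u v = ≈-trans (≈-reflexive (cong ∏ (map-++ (lookup gs) u v)))
      (∏-++ (map (lookup gs) u) (map (lookup gs) v))

    spell : ∀ {xs} → All (_∈ gs) xs → ∃[ w ] xs ≡ map (lookup gs) w
    spell []         = [] , refl
    spell (x∈ ∷ xs∈) with w , eq ← spell xs∈ = index x∈ ∷ w , cong₂ _∷_ (Any.lookup-index x∈) eq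

    -- A submonoid of ℕᴺ is finitely presented as soon as it is finitely
    -- generated: a pair (u , v) of words is encoded as a word on two copies of
    -- the alphabet, and the pairs of equal value are cut out by linear equations.

    finitelyPresented : (∀ x → ∃[ xs ] All (_∈ gs) xs × x ≈ ∏ xs) →
      ∀ N (φ : ℕ → Carrier → ℕ) →
      (∀ i {x y} → x ≈ y → φ i x ≡ φ i y) →
      (∀ i x y → φ i (x ∙ y) ≡ φ i x + φ i y) →
      (∀ i → φ i ε ≡ 0) →
      (∀ {x y} → (∀ i → i < N → φ i x ≡ φ i y) → x ≈ y) →
      FinitelyPresented monoid
    finitelyPresented gen N φ φ-cong φ-∙ φ-ε φ-injective = n , R , value , record
      { isMonoidMonomorphism = record
        { isMonoidHomomorphism = record
          { isMagmaHomomorphism = record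
            { isRelHomomorphism = record { cong = sound }
            ; homo = value-++
            }
          ; ε-homo = ≈-refl
          }
        ; injective = complete
        }
      ; surjective = λ x →
          let xs , xs∈ , x≈ = gen x
              w , xs≡ = spell xs∈
          in w , λ u≈w → ≈-trans (sound u≈w)
               (≈-sym (≈-trans x≈ (≈-reflexive (cong ∏ xs≡))))
      }
      where
      lefts rights : List Letter → Word n
      lefts  = mapMaybe isInj₁
      rights = mapMaybe isInj₂

      left right : (Fin n → ℕ) → Letter → ℕ
      left  h = Sum.[ h , const 0 ]
      right h = Sum.[ const 0 , h ]

      weight-left : ∀ h w → weight (left h) w ≡ weight h (lefts w)
      weight-left h []           = refl
      weight-left h (inj₁ x ∷ w) = cong (h x +_) (weight-left h w)
      weight-left h (inj₂ x ∷ w) = weight-left h w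

      weight-right : ∀ h w → weight (right h) w ≡ weight h (rights w)
      weight-right h []           = refl
      weight-right h (inj₁ x ∷ w) = weight-right h w
      weight-right h (inj₂ x ∷ w) = cong (h x +_) (weight-right h w)

      coordinate : ℕ → Fin n → ℕ
      coordinate i = φ i ∘ lookup gs

      φ-value : ∀ i w → φ i (value w) ≡ weight (coordinate i) w
      φ-value i []      = φ-ε i
      φ-value i (x ∷ w) = trans (φ-∙ i _ _) (cong (coordinate i x +_) (φ-value i w))

      letters : List Letter
      letters = map inj₁ (allFin n) ++ map inj₂ (allFin n)

      ∈-letters : ∀ x → x ∈ letters
      ∈-letters (inj₁ x) = ∈-++⁺ˡ (∈-map⁺ inj₁ (∈-allFin x))
      ∈-letters (inj₂ x) = ∈-++⁺ʳ (map inj₁ (allFin n)) (∈-map⁺ inj₂ (∈-allFin x))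

      ≤-constraint ≥-constraint : ℕ → Constraint Letter
      ≤-constraint i = left (coordinate i) , right (coordinate i)
      ≥-constraint i = right (coordinate i) , left (coordinate i)

      constraints : List (Constraint Letter)
      constraints = map ≤-constraint (upTo N) ++ map ≥-constraint (upTo N)

      Balanced : List Letter → Set
      Balanced w = All (w ⊨_) constraints

      balanced⇒≈ : ∀ {w} → Balanced w → value (lefts w) ≈ value (rights w)
      balanced⇒≈ {w} bal = φ-injective λ i i<N →
        let i∈ = ∈-upTo⁺ i<N
            ≤R = All.lookup bal (∈-++⁺ˡ (∈-map⁺ ≤-constraint i∈))
            ≤L = All.lookup bal (∈-++⁺ʳ (map ≤-constraint (upTo N)) (∈-map⁺ ≥-constraint i∈))
        in begin
          φ i (value (lefts w))            ≡⟨ φ-value i (lefts w) ⟩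
          weight (coordinate i) (lefts w)  ≡⟨ weight-left (coordinate i) w ⟨
          weight (left (coordinate i)) w   ≡⟨ ≤-antisym ≤R ≤L ⟩
          weight (right (coordinate i)) w  ≡⟨ weight-right (coordinate i) w ⟩
          weight (coordinate i) (rights w) ≡⟨ φ-value i (rights w) ⟨
          φ i (value (rights w))           ∎
        where open ≡-Reasoning

      ≈⇒balanced : ∀ w → value (lefts w) ≈ value (rights w) → Balanced w
      ≈⇒balanced w eq = All.++⁺
        (All.map⁺ {xs = upTo N} (All.tabulate λ {i} _ → ≤-reflexive (agree i)))
        (All.map⁺ {xs = upTo N} (All.tabulate λ {i} _ → ≤-reflexive (sym (agree i))))
        where
        open ≡-Reasoning
        agree : ∀ i → weight (left (coordinate i)) w ≡ weight (right (coordinate i)) w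
        agree i = begin
          weight (left (coordinate i)) w   ≡⟨ weight-left (coordinate i) w ⟩
          weight (coordinate i) (lefts w)  ≡⟨ φ-value i (lefts w) ⟨
          φ i (value (lefts w))            ≡⟨ φ-cong i eq ⟩
          φ i (value (rights w))           ≡⟨ φ-value i (rights w) ⟩
          weight (coordinate i) (rights w) ≡⟨ weight-right (coordinate i) w ⟨
          weight (right (coordinate i)) w  ∎

      abstract
        basis : FiniteBasis letters Balanced
        basis = gordan letters constraints

      Ws : List (List Letter)
      Ws = proj₁ basis

      commutator : Fin n → Fin n → Word n × Word n
      commutator x y = x ∷ y ∷ [] , y ∷ x ∷ []

      sides : List Letter → Word n × Word n
      sides w = lefts w , rights w

      -- The basis decomposes a balanced word only up to the order of its letters, so the
      -- commutators are added to the pairs read off the basis.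
      kernel commutators R : List (Word n × Word n)
      kernel      = map sides Ws
      commutators = cartesianProductWith commutator (allFin n) (allFin n)
      R           = kernel ++ commutators

      sound : ∀ {u v} → Congruence R u v → value u ≈ value v
      sound (rel uv∈) with ∈-++⁻ kernel uv∈
      ... | inj₁ ∈kernel with W , W∈ , refl ← ∈-map⁻ sides ∈kernel =
        balanced⇒≈ {W} (proj₂ (All.lookup (proj₁ (proj₂ basis)) W∈))
      ... | inj₂ ∈commutators
        with x , y , _ , _ , refl ←
               ∈-cartesianProductWith⁻ commutator (allFin n) (allFin n) ∈commutators =
        ≈-trans (≈-sym (assoc _ _ _)) (≈-trans (∙-cong (comm _ _) ≈-refl) (assoc _ _ _))
      sound ≈refl        = ≈-refl
      sound (≈sym p)     = ≈-sym (sound p)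
      sound (≈trans p q) = ≈-trans (sound p) (sound q)
      sound (≈++ {u} {u′} {v} {v′} p q) =
        ≈-trans (value-++ u v) (≈-trans (∙-cong (sound p) (sound q)) (≈-sym (value-++ u′ v′)))

      ↭⇒congruent : ∀ {u v} → u ↭ v → Congruence R u v
      ↭⇒congruent refl↭        = ≈refl
      ↭⇒congruent (prep x p)   = ≈++ {u = [ x ]} ≈refl (↭⇒congruent p)
      ↭⇒congruent (swap x y p) = ≈++ {u = x ∷ y ∷ []} {u′ = y ∷ x ∷ []}
        (rel (∈-++⁺ʳ kernel (∈-cartesianProductWith⁺ commutator (∈-allFin x) (∈-allFin y))))
        (↭⇒congruent p)
      ↭⇒congruent (trans↭ p q) = ≈trans (↭⇒congruent p) (↭⇒congruent q)

      concat-congruent : ∀ {vs} → All (_∈ Ws) vs →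
                         Congruence R (lefts (concat vs)) (rights (concat vs))
      concat-congruent []               = ≈refl
      concat-congruent {v ∷ vs} (v∈ ∷ vs∈) = subst₂ (Congruence R)
        (sym (mapMaybe-++ isInj₁ v (concat vs)))
        (sym (mapMaybe-++ isInj₂ v (concat vs)))
        (≈++ (rel (∈-++⁺ˡ (∈-map⁺ sides v∈))) (concat-congruent vs∈))

      balanced⇒congruent : ∀ w → Balanced w → Congruence R (lefts w) (rights w)
      balanced⇒congruent w bal =
        let vs , vs∈ , w↭ = proj₂ (proj₂ basis) w (All.tabulate λ {x} _ → ∈-letters x) bal
        in ≈trans (↭⇒congruent (mapMaybe-↭ isInj₁ w↭))
             (≈trans (concat-congruent vs∈)
               (↭⇒congruent (↭-sym (mapMaybe-↭ isInj₂ w↭))))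

      complete : ∀ {u v} → value u ≈ value v → Congruence R u v
      complete {u} {v} u≈v = subst₂ (Congruence R) lefts≡ rights≡
        (balanced⇒congruent w (≈⇒balanced w
          (≈-trans (≈-reflexive (cong value lefts≡))
            (≈-trans u≈v (≈-reflexive (cong value (sym rights≡)))))))
        where
        w : List Letter
        w = map inj₁ u ++ map inj₂ v
        lefts≡ : lefts w ≡ u
        lefts≡ = trans (mapMaybe-++ isInj₁ (map inj₁ u) (map inj₂ v))
          (trans (cong₂ _++_ (mapMaybeIsInj₁∘mapInj₁ u) (mapMaybeIsInj₁∘mapInj₂ v))
            (++-identityʳ u))
        rights≡ : rights w ≡ v
        rights≡ = trans (mapMaybe-++ isInj₂ (map inj₁ u) (map inj₂ v))
          (cong₂ _++_ (mapMaybeIsInj₂∘mapInj₁ u) (mapMaybeIsInj₂∘mapInj₂ v))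

-- Eventually periodic sequences as finite words

-- Interchange of two finite sums. It makes partial sums linear in the letters of a word, so that
-- conditions on `S` become constraints.
S-weight : ∀ {a} {X : Set a} (h : ℕ → X → ℕ) w n →
           S (λ i → weight (h i) w) n ≡ weight (λ x → S (λ i → h i x) n) w
S-weight h []      zero    = refl
S-weight h []      (suc n) = S-weight (h ∘ suc) [] n
S-weight h (x ∷ w) n       = trans (S-distrib (λ i → h i x) (λ i → weight (h i) w) n)
  (cong (S (λ i → h i x) n +_) (S-weight h w n))

indicator : ℕ → ℕ → ℕ
indicator i x = if does (i ≟ x) then 1 else 0

indicator-refl : ∀ i → indicator i i ≡ 1
indicator-refl i = cong (if_then 1 else 0) (dec-true (i ≟ i) refl)

indicator-≢ : ∀ {i x} → i ≢ x → indicator i x ≡ 0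
indicator-≢ {i} {x} i≢x = cong (if_then 1 else 0) (dec-false (i ≟ x) i≢x)

count : ℕ → List ℕ → ℕ
count i = weight (indicator i)

count-replicate : ∀ i c x → count i (replicate c x) ≡ c * indicator i x
count-replicate i zero    x = refl
count-replicate i (suc c) x = cong (indicator i x +_) (count-replicate i c x)

-- The word in which each i < n occurs e i times.

multiset : Seq → ℕ → List ℕ
multiset e zero    = []
multiset e (suc n) = replicate (e n) n ++ multiset e n

multiset-∈ : ∀ e n → All (_∈ upTo n) (multiset e n)
multiset-∈ e zero    = []
multiset-∈ e (suc n) = All.++⁺ (All.replicate⁺ (e n) (∈-upTo⁺ (n<1+n n)))
  (All.map (λ x∈ → ∈-upTo⁺ (m<n⇒m<1+n (∈-upTo⁻ x∈))) (multiset-∈ e n))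

count-multiset-≥ : ∀ e n {i} → n ≤ i → count i (multiset e n) ≡ 0
count-multiset-≥ e zero        n≤i = refl
count-multiset-≥ e (suc n) {i} n<i = begin
  count i (replicate (e n) n ++ multiset e n)         ≡⟨ weight-++ (indicator i) (replicate (e n) n) _ ⟩
  count i (replicate (e n) n) + count i (multiset e n)
    ≡⟨ cong₂ _+_ (count-replicate i (e n) n) (count-multiset-≥ e n (<⇒≤ n<i)) ⟩
  e n * indicator i n + 0                             ≡⟨ +-identityʳ _ ⟩
  e n * indicator i n                                 ≡⟨ cong (e n *_) (indicator-≢ (<⇒≢ n<i ∘ sym)) ⟩
  e n * 0                                             ≡⟨ *-zeroʳ (e n) ⟩
  0                                                   ∎
  where open ≡-Reasoning

count-multiset : ∀ e n {i} → i < n → count i (multiset e n) ≡ e i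
count-multiset e (suc n) {i} i<1+n = begin
  count i (replicate (e n) n ++ multiset e n)         ≡⟨ weight-++ (indicator i) (replicate (e n) n) _ ⟩
  count i (replicate (e n) n) + count i (multiset e n)
    ≡⟨ cong (_+ count i (multiset e n)) (count-replicate i (e n) n) ⟩
  e n * indicator i n + count i (multiset e n)        ≡⟨ last ⟩
  e i                                                 ∎
  where
  open ≡-Reasoning
  last : e n * indicator i n + count i (multiset e n) ≡ e i
  last with m≤n⇒m<n∨m≡n (s≤s⁻¹ i<1+n)
  ... | inj₁ i<n = cong₂ _+_
    (trans (cong (e n *_) (indicator-≢ (<⇒≢ i<n))) (*-zeroʳ (e n))) (count-multiset e n i<n)
  ... | inj₂ refl = trans
    (cong₂ _+_ (trans (cong (e n *_) (indicator-refl n)) (*-identityʳ (e n)))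
               (count-multiset-≥ e n ≤-refl))
    (+-identityʳ (e n))

-- Sequences with e (P + i) = e i for i ≥ N are encoded by their first
-- Q = P + N terms, and ρ i < Q is the position carrying the term i.

module Tail (P N : ℕ) .{{_ : NonZero P}} where
  open ≤-Reasoning

  Q : ℕ
  Q = P + N

  1≤P : 1 ≤ P
  1≤P = >-nonZero⁻¹ P

  ρ : ℕ → ℕ
  ρ i = i ⊓ N + (i ∸ N) % P

  ρ<Q : ∀ i → ρ i < Q
  ρ<Q i = begin-strict
    i ⊓ N + (i ∸ N) % P  <⟨ +-mono-≤-< (m⊓n≤n i N) (m%n<n (i ∸ N) P) ⟩
    N + P                ≡⟨ +-comm N P ⟩
    P + N                ∎

  ρ-fixes : ∀ {i} → i < Q → ρ i ≡ i
  ρ-fixes {i} i<Q = begin-equality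
    i ⊓ N + (i ∸ N) % P  ≡⟨ cong (i ⊓ N +_) (m<n⇒m%n≡m i∸N<P) ⟩
    i ⊓ N + (i ∸ N)      ≡⟨ m⊓n+m∸n i N ⟩
    i                    ∎
    where
    m⊓n+m∸n : ∀ m n → m ⊓ n + (m ∸ n) ≡ m
    m⊓n+m∸n m n = trans (cong (_+ (m ∸ n)) (⊓-comm m n)) (m⊓n+n∸m≡n n m)
    i∸N<P : i ∸ N < P
    i∸N<P = m<n+o⇒m∸n<o i N (subst (i <_) (+-comm P N) i<Q)

  ρ-periodic : ∀ {i} → N ≤ i → ρ (P + i) ≡ ρ i
  ρ-periodic {i} N≤i = cong₂ _+_
    (trans (m≥n⇒m⊓n≡n (≤-trans N≤i (m≤n+m i P))) (sym (m≥n⇒m⊓n≡n N≤i)))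
    (begin-equality
      (P + i ∸ N) % P    ≡⟨ cong (_% P) (+-∸-assoc P N≤i) ⟩
      (P + (i ∸ N)) % P  ≡⟨ cong (_% P) (+-comm P (i ∸ N)) ⟩
      (i ∸ N + P) % P    ≡⟨ [m+n]%n≡m%n (i ∸ N) P ⟩
      (i ∸ N) % P        ∎)

  Periodic : Seq → Set
  Periodic e = ∀ i → e i ≡ e (ρ i)

  beyond : ∀ {i} → ¬ (i < Q) → ∃[ j ] N ≤ j × i ≡ P + j
  beyond {i} i≮Q = i ∸ P , m+n≤o⇒m≤o∸n N (subst (_≤ i) (+-comm P N) Q≤i) ,
    sym (m+[n∸m]≡n (≤-trans (m≤m+n P N) Q≤i))
    where
    Q≤i : Q ≤ i
    Q≤i = ≮⇒≥ i≮Q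

  periodic-≗ : ∀ {e f} → Periodic e → Periodic f → (∀ {i} → i < Q → e i ≡ f i) → ∀ i → e i ≡ f i
  periodic-≗ pe pf eq i = trans (pe i) (trans (eq (ρ<Q i)) (sym (pf i)))

  -- Stronger than `Periodic`: every block of `P` consecutive terms in the tail must also have the
  -- sum `S e P` of the first `P` terms.
  Additive : Seq → Set
  Additive e = ∀ n → N ≤ n → S e (P + n) ≡ S e P + S e n

  -- Subtracting the identities at `n` and `suc n` gives `e (P + n) ≡ e n`; descent by `P` then
  -- reaches a position below `Q`.
  additive⇒periodic : ∀ {e} → Additive e → Periodic e
  additive⇒periodic {e} add = <-rec _ step
    where
    shift-eq : ∀ n → N ≤ n → e (P + n) ≡ e n
    shift-eq n N≤n = +-cancelˡ-≡ (S e P + S e n) _ _ (begin-equality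
      S e P + S e n + e (P + n)  ≡⟨ cong (_+ e (P + n)) (add n N≤n) ⟨
      S e (P + n) + e (P + n)    ≡⟨ S-suc e (P + n) ⟨
      S e (suc (P + n))          ≡⟨ cong (S e) (+-suc P n) ⟨
      S e (P + suc n)            ≡⟨ add (suc n) (m≤n⇒m≤1+n N≤n) ⟩
      S e P + S e (suc n)        ≡⟨ cong (S e P +_) (S-suc e n) ⟩
      S e P + (S e n + e n)      ≡⟨ +-assoc (S e P) _ _ ⟨
      S e P + S e n + e n        ∎)
    step : ∀ i → (∀ {j} → j < i → e j ≡ e (ρ j)) → e i ≡ e (ρ i)
    step i rec with i <? Q
    ... | yes i<Q = cong e (sym (ρ-fixes i<Q))
    ... | no i≮Q with j , N≤j , refl ← beyond i≮Q = begin-equality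
      e (P + j)      ≡⟨ shift-eq j N≤j ⟩
      e j            ≡⟨ rec (m<n+m j 1≤P) ⟩
      e (ρ j)        ≡⟨ cong e (ρ-periodic N≤j) ⟨
      e (ρ (P + j))  ∎

  -- Raising `n` by one adds the same term to both sides, so the identity at `n = N` suffices.
  -- Additivity thus costs a single equation besides periodicity.
  periodic⇒additive : ∀ {e} → Periodic e → S e Q ≡ S e P + S e N → Additive e
  periodic⇒additive {e} per base n N≤n =
    subst (λ n → S e (P + n) ≡ S e P + S e n) (m+[n∸m]≡n N≤n) (go (n ∸ N))
    where
    shift-eq : ∀ n → N ≤ n → e (P + n) ≡ e n
    shift-eq n N≤n = trans (per (P + n)) (trans (cong e (ρ-periodic N≤n)) (sym (per n)))
    go : ∀ j → S e (P + (N + j)) ≡ S e P + S e (N + j)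
    go zero rewrite +-identityʳ N = base
    go (suc j) = begin-equality
      S e (P + (N + suc j))                  ≡⟨ cong (S e)
                                                  (trans (cong (P +_) (+-suc N j)) (+-suc P (N + j))) ⟩
      S e (suc (P + (N + j)))                ≡⟨ S-suc e _ ⟩
      S e (P + (N + j)) + e (P + (N + j))    ≡⟨ cong₂ _+_ (go j) (shift-eq (N + j) (m≤m+n N j)) ⟩
      S e P + S e (N + j) + e (N + j)        ≡⟨ +-assoc (S e P) _ _ ⟩
      S e P + (S e (N + j) + e (N + j))      ≡⟨ cong (S e P +_) (S-suc e (N + j)) ⟨
      S e P + S e (suc (N + j))              ≡⟨ cong (λ n → S e P + S e n) (+-suc N j) ⟨
      S e P + S e (N + suc j)                ∎

  -- Additivity lowers any argument that is at least `Q` by `P`, first the right one in `goʳ` and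
  -- then the left one in `go`. Infinitely many inequalities reduce to finitely many.
  additive⇒super : ∀ {e} → Additive e → (∀ {a b} → a ≤ Q → b ≤ Q → S e a + S e b ≤ S e (a + b)) →
                   ∀ n → SuperAt e n
  additive⇒super {e} add small n a b refl = go a b
    where
    goʳ : ∀ {a} → a ≤ Q → ∀ b → S e a + S e b ≤ S e (a + b)
    goʳ {a} a≤Q = <-rec _ λ b rec → step b rec
      where
      step : ∀ b → (∀ {j} → j < b → S e a + S e j ≤ S e (a + j)) → S e a + S e b ≤ S e (a + b)
      step b rec with b <? Q
      ... | yes b<Q = small a≤Q (<⇒≤ b<Q)
      ... | no b≮Q with j , N≤j , refl ← beyond b≮Q = begin
        S e a + S e (P + j)        ≡⟨ cong (S e a +_) (add j N≤j) ⟩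
        S e a + (S e P + S e j)    ≡⟨ solve 3 (λ x y z → x :+ (y :+ z) := y :+ (x :+ z)) refl
                                        (S e a) (S e P) (S e j) ⟩
        S e P + (S e a + S e j)    ≤⟨ +-monoʳ-≤ (S e P) (rec (m<n+m j 1≤P)) ⟩
        S e P + S e (a + j)        ≡⟨ add (a + j) (≤-trans N≤j (m≤n+m j a)) ⟨
        S e (P + (a + j))          ≡⟨ cong (S e) (solve 3 (λ x y z → x :+ (y :+ z) := y :+ (x :+ z)) refl
                                        P a j) ⟩
        S e (a + (P + j))          ∎
        where open +-*-Solver
    go : ∀ a b → S e a + S e b ≤ S e (a + b)
    go = <-rec _ λ a rec → step a rec
      where
      step : ∀ a → (∀ {j} → j < a → ∀ b → S e j + S e b ≤ S e (j + b)) →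
             ∀ b → S e a + S e b ≤ S e (a + b)
      step a rec b with a <? Q
      ... | yes a<Q = goʳ (<⇒≤ a<Q) b
      ... | no a≮Q with j , N≤j , refl ← beyond a≮Q = begin
        S e (P + j) + S e b        ≡⟨ cong (_+ S e b) (add j N≤j) ⟩
        S e P + S e j + S e b      ≡⟨ +-assoc (S e P) _ _ ⟩
        S e P + (S e j + S e b)    ≤⟨ +-monoʳ-≤ (S e P) (rec (m<n+m j 1≤P) b) ⟩
        S e P + S e (j + b)        ≡⟨ add (j + b) (≤-trans N≤j (m≤m+n j b)) ⟨
        S e (P + (j + b))          ≡⟨ cong (S e) (+-assoc P j b) ⟨
        S e (P + j + b)            ∎

  -- Binomid and splitting conditions as linear constraints

  decode : List ℕ → Seq
  decode w i = count (ρ i) w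

  decode-periodic : ∀ w → Periodic (decode w)
  decode-periodic w i = cong (λ j → count j w) (sym (ρ-fixes (ρ<Q i)))

  decode-multiset : ∀ {e} → Periodic e → ∀ i → decode (multiset e Q) i ≡ e i
  decode-multiset {e} per i = trans (count-multiset e Q (ρ<Q i)) (sym (per i))

  decode-concat : ∀ vs i → decode (concat vs) i ≡ weight (λ v → decode v i) vs
  decode-concat vs i = weight-concat (indicator (ρ i)) vs

  -- The number of `i < n` with `ρ i = x`, that is, the coefficient of the multiplicity of `x` in
  -- the partial sum of length `n`.
  t : ℕ → ℕ → ℕ
  t n x = S (λ i → indicator (ρ i) x) n

  S-decode : ∀ w n → S (decode w) n ≡ weight (t n) w
  S-decode w n = S-weight (λ i → indicator (ρ i)) w n

  S-decode-+ : ∀ w a b → S (decode w) a + S (decode w) b ≡ weight (λ x → t a x + t b x) w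
  S-decode-+ w a b = trans (cong₂ _+_ (S-decode w a) (S-decode w b)) (sym (weight-+ (t a) (t b) w))

  superC : ℕ → ℕ → Constraint ℕ
  superC a b = (λ x → t a x + t b x) , t (a + b)

  superC⁺ : ∀ w a b → S (decode w) a + S (decode w) b ≤ S (decode w) (a + b) → w ⊨ superC a b
  superC⁺ w a b = subst₂ _≤_ (S-decode-+ w a b) (S-decode w (a + b))

  superC⁻ : ∀ w a b → w ⊨ superC a b → S (decode w) a + S (decode w) b ≤ S (decode w) (a + b)
  superC⁻ w a b = subst₂ _≤_ (sym (S-decode-+ w a b)) (sym (S-decode w (a + b)))

  splitC : ℕ → ℕ → ℕ → Constraint ℕ
  splitC n a b = t n , (λ x → t a x + t b x)

  splitC⁺ : ∀ w n a b → S (decode w) n ≤ S (decode w) a + S (decode w) b → w ⊨ splitC n a b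
  splitC⁺ w n a b = subst₂ _≤_ (S-decode w n) (S-decode-+ w a b)

  splitC⁻ : ∀ w n a b → w ⊨ splitC n a b → S (decode w) n ≤ S (decode w) a + S (decode w) b
  splitC⁻ w n a b = subst₂ _≤_ (sym (S-decode w n)) (sym (S-decode-+ w a b))

  module System (m : ℕ) (1≤N : 1 ≤ N) where

    -- The first constraint and the superadditivity constraint for `P` and `N` together give the
    -- equation from which `periodic⇒additive` starts.
    conjunctive : List (Constraint ℕ)
    conjunctive = splitC Q P N ∷ cartesianProductWith superC (upTo (suc Q)) (upTo (suc Q))

    -- One alternative for each way of writing `suc m + j` as an ordered sum of two positive
    -- numbers.
    splittings : ℕ → List (Constraint ℕ)
    splittings j = applyUpTo (λ i → splitC (suc m + j) (suc i) (m + j ∸ i)) (m + j)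

    -- The range `j < Q` covers every length between `m` and `Q`; from `Q` on additivity supplies a
    -- splitting.
    disjunctive : List (List (Constraint ℕ))
    disjunctive = map splittings (upTo Q)

    Solution : List ℕ → Set
    Solution w = All (w ⊨_) conjunctive × All (Any (w ⊨_)) disjunctive

    module _ (w : List ℕ) (sol : Solution w) where
      private
        e : Seq
        e = decode w

      small : ∀ {a b} → a ≤ Q → b ≤ Q → S e a + S e b ≤ S e (a + b)
      small {a} {b} a≤Q b≤Q = superC⁻ w a b (All.lookup (proj₁ sol)
        (there (∈-cartesianProductWith⁺ superC (∈-upTo⁺ (s≤s a≤Q)) (∈-upTo⁺ (s≤s b≤Q)))))

      solution⇒additive : Additive e
      solution⇒additive = periodic⇒additive (decode-periodic w) (≤-antisym
        (splitC⁻ w Q P N (All.lookup (proj₁ sol) (here refl)))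
        (small (m≤m+n P N) (m≤n+m N P)))

      solution⇒super : ∀ n → SuperAt e n
      solution⇒super = additive⇒super solution⇒additive small

      solution⇒splits : Splits e m
      solution⇒splits n m<n with n <? Q
      -- Here `P` is split off, and `1 ≤ N` makes the other summand positive.
      ... | no n≮Q with j , N≤j , refl ← beyond n≮Q =
        P , j , 1≤P , ≤-trans 1≤N N≤j , refl , solution⇒additive j N≤j
      solution⇒splits n m<n | yes n<Q with j , refl ← m≤n⇒∃[o]m+o≡n m<n
        with i , i<m+j , holds ← Any.applyUpTo⁻ (λ i → splitC (suc m + j) (suc i) (m + j ∸ i))
               (All.lookup (proj₂ sol) (∈-map⁺ splittings
                 (∈-upTo⁺ (≤-<-trans (m≤n+m j (suc m)) n<Q)))) =
        suc i , m + j ∸ i , s≤s z≤n , m<n⇒0<n∸m i<m+j , sum≡ ,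
        ≤-antisym (splitC⁻ w (suc m + j) (suc i) (m + j ∸ i) holds)
          (solution⇒super (suc m + j) (suc i) (m + j ∸ i) sum≡)
        where
        sum≡ : suc i + (m + j ∸ i) ≡ suc m + j
        sum≡ = cong suc (m+[n∸m]≡n (<⇒≤ i<m+j))

    multiset-solution : ∀ {e} → IsBinomid e → Splits e m → Additive e → Solution (multiset e Q)
    multiset-solution {e} be spl add =
      splitC⁺ w Q P N (≤-reflexive (trans (S≡ Q)
        (trans (add N ≤-refl) (sym (cong₂ _+_ (S≡ P) (S≡ N)))))) ∷
      All.cartesianProductWith⁺ (setoid ℕ) (setoid ℕ) superC (upTo (suc Q)) (upTo (suc Q))
        (λ {a} {b} _ _ → superC⁺ w a b (subst₂ _≤_
          (sym (cong₂ _+_ (S≡ a) (S≡ b))) (sym (S≡ (a + b))) (binomid⇒super be (a + b) a b refl))) ,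
      All.map⁺ {xs = upTo Q} (All.tabulate λ {j} _ → splitting j)
      where
      w : List ℕ
      w = multiset e Q
      S≡ : ∀ n → S (decode w) n ≡ S e n
      S≡ n = S-cong n λ i _ → decode-multiset (additive⇒periodic add) i
      splitting : ∀ j → Any (w ⊨_) (splittings j)
      splitting j with spl (suc m + j) (s≤s (m≤m+n m j))
      ... | suc i , b , _ , 1≤b , eq , S-eq = Any.applyUpTo⁺ _
        {i = i} (subst (λ c → w ⊨ splitC (suc m + j) (suc i) c) b≡
          (splitC⁺ w (suc m + j) (suc i) b (≤-reflexive
            (trans (S≡ (suc m + j)) (trans S-eq (sym (cong₂ _+_ (S≡ (suc i)) (S≡ b))))))))
        i<m+j
        where
        i+b : i + b ≡ m + j
        i+b = suc-injective eq
        b≡ : b ≡ m + j ∸ i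
        b≡ = trans (sym (m+n∸m≡n i b)) (cong (_∸ i) i+b)
        i<m+j : i < m + j
        i<m+j = subst (i <_) i+b (m<m+n i 1≤b)

    abstract
      basis : FiniteBasis (upTo Q) Solution
      basis = gordanAny (upTo Q) conjunctive disjunctive

-- Lex-minimal extensions of indices of a fixed length

reduce-∈ : ∀ {a b p} {A : Set a} {B : Set b} {P : A → Set p} (f : ∀ {x} → P x → B)
           {x xs} (ps : All P xs) → x ∈ xs → ∃[ p ] f {x} p ∈ All.reduce f ps
reduce-∈ f (p ∷ ps) (here refl) = p , here refl
reduce-∈ f (p ∷ ps) (there x∈)    = let q , q∈ = reduce-∈ f ps x∈ in q , there q∈

All-reduce : ∀ {a b p q} {A : Set a} {B : Set b} {P : A → Set p} {Q : B → Set q} (f : ∀ {x} → P x → B)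
             {xs} (ps : All P xs) → (∀ {x} (p : P x) → Q (f p)) → All Q (All.reduce f ps)
All-reduce f []       q = []
All-reduce f (p ∷ ps) q = q p ∷ All-reduce f ps q

term≤S : ∀ e {i n} → i < n → e i ≤ S e n
term≤S e {i} {n} i<n = begin
  e i              ≤⟨ m≤n+m (e i) (S e i) ⟩
  S e i + e i      ≡⟨ S-suc e i ⟨
  S e (suc i)      ≤⟨ S-mono e (suc i) (n ∸ suc i) ⟩
  S e (suc i + (n ∸ suc i))  ≡⟨ cong (S e) (m+[n∸m]≡n i<n) ⟩
  S e n            ∎
  where open ≤-Reasoning

Splits-cong : ∀ {e f m} → (∀ i → e i ≡ f i) → Splits e m → Splits f m
Splits-cong {e} {f} eq spl n m<n with a , b , 1≤a , 1≤b , a+b , S-eq ← spl n m<n =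
  a , b , 1≤a , 1≤b , a+b ,
  trans (sym (S≡ n)) (trans S-eq (cong₂ _+_ (S≡ a) (S≡ b)))
  where
  S≡ : ∀ n → S e n ≡ S f n
  S≡ n = S-cong n λ i _ → eq i

Splits-mono : ∀ {e m n} → m ≤ n → Splits e m → Splits e n
Splits-mono m≤n spl l n<l = spl l (≤-<-trans m≤n n<l)

-- Superadditivity of both summands leaves no room for either to be strict
-- where their sum is an equality.

Splits-summand : ∀ {e f g m} → IsBinomid f → IsBinomid g → (∀ i → e i ≡ f i + g i) →
                 Splits e m → Splits f m
Splits-summand {e} {f} {g} bf bg eq spl n m<n with a , b , 1≤a , 1≤b , refl , S-eq ← spl n m<n =
  a , b , 1≤a , 1≤b , refl , ≤-antisym (+-cancelʳ-≤ (S g n) _ _ (begin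
    S f n + S g n                      ≡⟨ S≡ n ⟨
    S e n                              ≡⟨ S-eq ⟩
    S e a + S e b                      ≡⟨ cong₂ _+_ (S≡ a) (S≡ b) ⟩
    (S f a + S g a) + (S f b + S g b)  ≡⟨ solve 4 (λ x y z w →
                                            (x :+ y) :+ (z :+ w) := (x :+ z) :+ (y :+ w))
                                            refl (S f a) (S g a) (S f b) (S g b) ⟩
    (S f a + S f b) + (S g a + S g b)  ≤⟨ +-monoʳ-≤ (S f a + S f b) (binomid⇒super bg n a b refl) ⟩
    S f a + S f b + S g n              ∎))
    (binomid⇒super bf n a b refl)
  where
  open ≤-Reasoning
  open +-*-Solver
  S≡ : ∀ n → S e n ≡ S f n + S g n
  S≡ n = trans (S-cong n λ i _ → eq i) (S-distrib f g n)

seq : 𝕃.Carrier → Seq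
seq x = proj₁ (proj₁ x)

seq-binomid : ∀ x → IsBinomid (seq x)
seq-binomid x = proj₂ (proj₁ x)

Lₖ𝕀ₖ⇒splits : ∀ k x → Lₖ𝕀ₖ k x → Splits (seq x) (suc k)
Lₖ𝕀ₖ⇒splits k x (η , x≈) =
  Splits-cong (λ i → sym (x≈ i)) (lexMin⇒splits η (proj₂ (lexMinExtension η)))

-- With `Lₖ𝕀ₖ⇒splits` this turns membership in the image of `L k` into a condition on `S` alone,
-- which visibly weakens as `k` grows and passes to binomid summands.
splits⇒Lₖ𝕀ₖ : ∀ k x → Splits (seq x) (suc k) → Lₖ𝕀ₖ k x
splits⇒Lₖ𝕀ₖ k x spl =
  η , lexMinExtension-unique (splits⇒lexMin (suc k) (seq-binomid x) spl) (proj₂ (lexMinExtension η))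
  where
  η : 𝕀[ suc k ]
  η = prefix (suc k) (seq x) , prefix-binomid (suc k) (seq-binomid x)

splits⇒𝕃 : ∀ k {e} → IsBinomid e → Splits e (suc k) → 𝕃.Carrier
splits⇒𝕃 k {e} be spl = (e , be) , k , (prefix (suc k) e , prefix-binomid (suc k) be) ,
  splits⇒lexMin (suc k) be spl

Lₖ𝕀ₖ-increasing : Increasing Lₖ𝕀ₖ
Lₖ𝕀ₖ-increasing {i} {j} i≤j {x} x∈ =
  splits⇒Lₖ𝕀ₖ j x (Splits-mono (s≤s i≤j) (Lₖ𝕀ₖ⇒splits i x x∈))

𝕃-level : ∀ x → Lₖ𝕀ₖ (proj₁ (proj₂ x)) x
𝕃-level x@(_ , k , η , mζ) = η , lexMinExtension-unique mζ (proj₂ (lexMinExtension η))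

-- Generated submonoids of `𝕃`

singleton∈ : ∀ {p} (A : Pred 𝕃.Carrier p) {x} → A x → ⟨ A ⟩ x
singleton∈ A {x} x∈ = [ x ] , x∈ ∷ [] , λ i → sym (+-identityʳ (seq x i))

⟨⟩-resp : ∀ {p} (A : Pred 𝕃.Carrier p) {x y} → x 𝕃.≈ y → ⟨ A ⟩ x → ⟨ A ⟩ y
⟨⟩-resp A x≈y (xs , xs∈ , x≈) = xs , xs∈ , λ i → trans (sym (x≈y i)) (x≈ i)

⟨⟩-mono : ∀ {p q} {A : Pred 𝕃.Carrier p} {B : Pred 𝕃.Carrier q} → A ⊆ B → ⟨ A ⟩ ⊆ ⟨ B ⟩
⟨⟩-mono A⊆B (xs , xs∈ , x≈) = xs , All.map A⊆B xs∈ , x≈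

⟨⟩-bind : ∀ {p q} {A : Pred 𝕃.Carrier p} {B : Pred 𝕃.Carrier q} → A ⊆ ⟨ B ⟩ → ⟨ A ⟩ ⊆ ⟨ B ⟩
⟨⟩-bind {A = A} {B} A⊆⟨B⟩ {x} (xs , xs∈ , x≈) =
  ⟨⟩-resp B {product xs} {x} (λ i → sym (x≈ i)) (products xs∈)
  where
  products : ∀ {xs} → All A xs → ⟨ B ⟩ (product xs)
  products []                 = [] , [] , λ _ → refl
  products {y ∷ ys} (y∈ ∷ ys∈) = ⟨⟩-closed B {y} {product ys} (A⊆⟨B⟩ y∈) (products ys∈)

-- The period of S found in Periodicity is at most m, so it divides m !.

uniformlyAdditive : ∀ k → let m = suc k in ∀ {e} → IsBinomid e → Splits e m →
                    ∀ n → suc (m + m * m) ≤ n → S e (m ! + n) ≡ S e (m !) + S e n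
uniformlyAdditive k {e} be spl n N≤n
  with j , j≤k , best ← Periodicity.maxRatio {e} be k spl k
  with divides c P≡ ← ∣-trans (m∣m*n {suc j} (j !)) (m≤n⇒m!∣n! (s≤s j≤k)) =
  ≤-antisym
    (subst (λ p → S e (p + n) ≤ S e p + S e n) (sym P≡)
      (periodic-* be (Periodicity.Exchange.periodic be k spl j best) c n
        -- The threshold from `Exchange` is `suc (m + p * m)` with `p = suc j`; since `p ≤ m`, it is
        -- at most `suc (m + m * m)`.
        (≤-trans (s≤s (+-monoʳ-≤ m (*-monoˡ-≤ m (s≤s j≤k)))) N≤n)))
    (binomid⇒super be (m ! + n) (m !) n refl)
  where
  m : ℕ
  m = suc k

-- Generators and finite presentation at a fixed length

module FixedLength (k P N : ℕ) .{{_ : NonZero P}} (1≤N : 1 ≤ N)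
                   (additive : ∀ {e} → IsBinomid e → Splits e (suc k) → Tail.Additive P N e) where

  private
    m : ℕ
    m = suc k

  open Tail P N
  open System m 1≤N

  Lₖ𝕀ₖ-additive : ∀ x → Lₖ𝕀ₖ k x → Additive (seq x)
  Lₖ𝕀ₖ-additive x x∈ = additive (seq-binomid x) (Lₖ𝕀ₖ⇒splits k x x∈)

  -- Periodicity passes to sums because `P` and `N` are the same for all summands. Hence the first
  -- `Q` terms determine an element of the generated monoid.
  ⟨⟩-periodic : ∀ {x} → ⟨ Lₖ𝕀ₖ k ⟩ x → Periodic (seq x)
  ⟨⟩-periodic (xs , xs∈ , x≈) i = trans (x≈ i) (trans (products xs∈ i) (sym (x≈ (ρ i))))
    where
    products : ∀ {xs} → All (Lₖ𝕀ₖ k) xs → Periodic (seq (product xs))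
    products []                  i = refl
    products {x ∷ xs} (x∈ ∷ xs∈) i =
      cong₂ _+_ (additive⇒periodic (Lₖ𝕀ₖ-additive x x∈) i) (products xs∈ i)

  element : ∀ {w} → All (_∈ upTo Q) w × Solution w → 𝕃.Carrier
  element {w} (_ , sol) = splits⇒𝕃 k (super⇒binomid (solution⇒super w sol)) (solution⇒splits w sol)

  abstract
    generators : List 𝕃.Carrier
    generators = All.reduce (λ {w} → element {w}) (proj₁ (proj₂ basis))

    generators⊆ : All (Lₖ𝕀ₖ k) generators
    generators⊆ = All-reduce (λ {w} → element {w}) (proj₁ (proj₂ basis))
      λ {w} p → splits⇒Lₖ𝕀ₖ k (element {w} p) (solution⇒splits w (proj₂ p))

    -- The multiset of the first `Q` terms solves the system, so up to order it is a concatenation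
    -- of basis words, and decoding turns concatenation into a sum.
    generates : ∀ x → Lₖ𝕀ₖ k x → ⟨ _∈ generators ⟩ x
    generates x x∈ =
      let e = seq x
          add = Lₖ𝕀ₖ-additive x x∈
          vs , vs∈ , w↭ = proj₂ (proj₂ basis) (multiset e Q) (multiset-∈ e Q)
            (multiset-solution (seq-binomid x) (Lₖ𝕀ₖ⇒splits k x x∈) add)
          ys , ys∈ , eq = elements vs∈
      in ys , ys∈ , λ i → trans (sym (decode-multiset (additive⇒periodic add) i))
           (trans (weight-↭ (indicator (ρ i)) w↭) (trans (decode-concat vs i) (sym (eq i))))
      where
      elements : ∀ {vs} → All (_∈ proj₁ basis) vs → ∃[ ys ] All (_∈ generators) ys ×
                 (∀ i → seq (product ys) i ≡ weight (λ v → decode v i) vs)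
      elements [] = [] , [] , λ _ → refl
      elements {v ∷ vs} (v∈ ∷ vs∈) =
        let p , y∈ = reduce-∈ (λ {w} → element {w}) (proj₁ (proj₂ basis)) v∈
            ys , ys∈ , eq = elements vs∈
        in element {v} p ∷ ys , y∈ ∷ ys∈ , λ i → cong (decode v i +_) (eq i)

  -- The first `Q` terms serve as the coordinates; they separate elements by the common periodicity.
  presentation : FinitelyPresented (CommutativeMonoid.monoid ⟨ Lₖ𝕀ₖ k ⟩ᴹ)
  presentation = Presentation.finitelyPresented ⟨ Lₖ𝕀ₖ k ⟩ᴹ gens generate Q
    (λ i x → seq (proj₁ x) i) (λ i x≈y → x≈y i) (λ _ _ _ → refl) (λ _ → refl)
    (λ {x} {y} eq → periodic-≗ (⟨⟩-periodic {proj₁ x} (proj₂ x))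
                               (⟨⟩-periodic {proj₁ y} (proj₂ y)) (eq _))
    where
    module M = CommutativeMonoid ⟨ Lₖ𝕀ₖ k ⟩ᴹ
    module G = Generated ⟨ Lₖ𝕀ₖ k ⟩ᴹ
    embed : ∀ {x} → Lₖ𝕀ₖ k x → M.Carrier
    embed {x} x∈ = x , singleton∈ (Lₖ𝕀ₖ k) {x} x∈
    gens : List M.Carrier
    gens = All.reduce (λ {y} → embed {y}) generators⊆
    lift : ∀ {ys} → All (_∈ generators) ys →
           ∃[ zs ] All (_∈ gens) zs × (∀ i → seq (product ys) i ≡ seq (proj₁ (G.product zs)) i)
    lift [] = [] , [] , λ _ → refl
    lift {y ∷ ys} (y∈ ∷ ys∈) =
      let p , z∈ = reduce-∈ (λ {y} → embed {y}) generators⊆ y∈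
          zs , zs∈ , eq = lift ys∈
      in embed {y} p ∷ zs , z∈ ∷ zs∈ , λ i → cong (seq y i +_) (eq i)
    generate : ∀ x → ∃[ zs ] All (_∈ gens) zs × x M.≈ G.product zs
    generate (x , x∈) =
      let ys , ys∈ , x≈ = ⟨⟩-bind {B = _∈ generators} (λ {y} → generates y) {x} x∈
          zs , zs∈ , eq = lift ys∈
      in zs , zs∈ , λ i → trans (x≈ i) (eq i)

  -- Longest factorisations and atoms

  size : 𝕃.Carrier → ℕ
  size x = S (seq x) Q

  size-product : ∀ xs → size (product xs) ≡ weight size xs
  size-product []       = S-weight {X = 𝕃.Carrier} (λ i x → seq x i) [] Q
  size-product (x ∷ xs) =
    trans (S-distrib (seq x) (seq (product xs)) Q) (cong (size x +_) (size-product xs))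

  size≡0 : ∀ x → ⟨ Lₖ𝕀ₖ k ⟩ x → size x ≡ 0 → x 𝕃.≈ 𝕃.ε
  size≡0 x x∈ size≡ = periodic-≗ (⟨⟩-periodic {x} x∈) (λ _ → refl)
    λ i<Q → n≤0⇒n≡0 (subst (seq x _ ≤_) size≡ (term≤S (seq x) i<Q))

  positive? : ∀ x → Dec (1 ≤ size x)
  positive? x = 1 ≤? size x

  -- Each remaining generator has `size` at least 1, and `size` is additive, so the number of
  -- factors in a factorisation is bounded. The discarded generators are zero by `size≡0`.
  nonzero : List 𝕃.Carrier
  nonzero = filter positive? generators

  nonzero⊆ : ∀ {x} → x ∈ nonzero → Lₖ𝕀ₖ k x
  nonzero⊆ x∈ = All.lookup generators⊆ (proj₁ (∈-filter⁻ positive? x∈))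

  nonzero-generates : ∀ x → Lₖ𝕀ₖ k x → ⟨ _∈ nonzero ⟩ x
  nonzero-generates x x∈ = ⟨⟩-bind {B = _∈ nonzero} letter {x} (generates x x∈)
    where
    letter : ∀ {y} → y ∈ generators → ⟨ _∈ nonzero ⟩ y
    letter {y} y∈ = by (positive? y)
      where
      by : Dec (1 ≤ size y) → ⟨ _∈ nonzero ⟩ y
      by (yes 1≤y) = singleton∈ (_∈ nonzero) {y} (∈-filter⁺ positive? y∈ 1≤y)
      by (no 1≰y)  = [] , [] ,
        size≡0 y (singleton∈ (Lₖ𝕀ₖ k) {y} (All.lookup generators⊆ y∈)) (n<1⇒n≡0 (≰⇒> 1≰y))

  length≤size : ∀ {xs} → All (_∈ nonzero) xs → length xs ≤ weight size xs
  length≤size []         = z≤n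
  length≤size (x∈ ∷ xs∈) = +-mono-≤ (proj₂ (∈-filter⁻ positive? {xs = generators} x∈)) (length≤size xs∈)

  _factors_ : List 𝕃.Carrier → 𝕃.Carrier → Set
  xs factors z = All (_∈ nonzero) xs × z 𝕃.≈ product xs

  factors-short : ∀ {xs z} → xs factors z → length xs ≤ size z
  factors-short {xs} {z} (xs∈ , z≈) = ≤-trans (length≤size xs∈)
    (≤-reflexive (trans (sym (size-product xs)) (S-cong Q λ i _ → sym (z≈ i))))

  Maximal : 𝕃.Carrier → List 𝕃.Carrier → Set
  Maximal z xs = xs factors z × (∀ ys → ys factors z → length ys ≤ length xs)

  -- Factorisations of `z` have at most `size z` factors, so the candidates form a finite list.
  -- Equality with `z` is tested on the first `Q` terms, which makes the existence of a longer
  -- factorisation decidable; periodicity extends the agreement to all terms.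
  maximalFactorisation : ∀ {z} → Lₖ𝕀ₖ k z → ∃ (Maximal z)
  maximalFactorisation {z} z∈ =
    let xs , fact = nonzero-generates z z∈ in search (size z) xs fact (m≤m+n (size z) (length xs))
    where
    ⟨⟩∋ : ∀ {xs} → All (_∈ nonzero) xs → ⟨ Lₖ𝕀ₖ k ⟩ (product xs)
    ⟨⟩∋ {xs} xs∈ = xs , All.map nonzero⊆ xs∈ , λ _ → refl

    Longer : List 𝕃.Carrier → List 𝕃.Carrier → Set
    Longer xs ys = length xs < length ys × (∀ {i} → i < Q → seq z i ≡ seq (product ys) i)

    longer? : ∀ xs ys → Dec (Longer xs ys)
    longer? xs ys = (length xs <? length ys) ×-dec
                    allUpTo? (λ i → seq z i ≟ seq (product ys) i) Q

    candidates : List (List 𝕃.Carrier)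
    candidates = wordsUpTo nonzero (size z)

    -- Each longer factorisation uses up one unit of fuel while `fuel + length xs` stays at least
    -- `size z`.
    search : ∀ fuel xs → xs factors z → size z ≤ fuel + length xs → ∃ (Maximal z)
    search fuel xs fact enough = by (Any.any? (longer? xs) candidates)
      where
      next : ∀ fuel ys → ys factors z → length xs < length ys → size z ≤ fuel + length xs →
             ∃ (Maximal z)
      next zero    ys yfact shorter enough =
        ⊥-elim (<⇒≱ shorter (≤-trans (factors-short {ys} {z} yfact) enough))
      next (suc f) ys yfact shorter enough = search f ys yfact (begin
        size z                 ≤⟨ enough ⟩
        suc f + length xs      ≡⟨ +-suc f (length xs) ⟨
        f + suc (length xs)    ≤⟨ +-monoʳ-≤ f shorter ⟩
        f + length ys          ∎)
        where open ≤-Reasoning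

      by : Dec (Any (Longer xs) candidates) → ∃ (Maximal z)
      by (no none)  = xs , fact , λ ys yfact → ≮⇒≥ λ shorter →
        none (lose (∈-wordsUpTo⁺ (proj₁ yfact) (factors-short {ys} {z} yfact))
                   (shorter , λ {i} _ → proj₂ yfact i))
      by (yes some) =
        let ys , ys∈ , shorter , eq = find some
            ys∈′ = ∈-wordsUpTo⁻ nonzero (size z) ys∈
        in next fuel ys
             (ys∈′ , periodic-≗ (additive⇒periodic (Lₖ𝕀ₖ-additive z z∈))
                       (⟨⟩-periodic {product ys} (⟨⟩∋ ys∈′)) eq)
             shorter enough

  -- A proper decomposition of a factor would yield a longer factorisation.

  factor-atom : ∀ {z} as g bs → Maximal z (as ++ g ∷ bs) → Atom (proj₁ g)
  factor-atom {z} as g bs ((ys∈ , z≈) , maximal) =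
    (λ g≈ε → <⇒≢ 1≤size (sym (size-zero g≈ε))) , atomic
    where
    open ≤-Reasoning

    g∈ : g ∈ nonzero
    g∈ = All.lookup ys∈ (∈-++⁺ʳ as (here refl))

    1≤size : 1 ≤ size g
    1≤size = proj₂ (∈-filter⁻ positive? {xs = generators} g∈)

    size-zero : g 𝕃.≈ 𝕃.ε → size g ≡ 0
    size-zero g≈ε = trans (S-cong Q λ i _ → g≈ε i) (size-product [])

    spl : Splits (seq g) (suc k)
    spl = Lₖ𝕀ₖ⇒splits k g (nonzero⊆ g∈)

    atomic : Atomic (proj₁ g)
    atomic ((e , be) , (f , bf) , e≢0 , f≢0 , g≈) =
      <⇒≱ longer (maximal (as ++ us ++ vs ++ bs) (All.++⁺ as∈ (All.++⁺ us∈ (All.++⁺ vs∈ bs∈)) , z≈′))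
      where
      -- In `Atomic` the summands are arbitrary binomid indices. Inheriting the splittings of `g`
      -- puts them into `Lₖ𝕀ₖ k`, so each has a factorisation into `nonzero`, of positive length as
      -- the summand is not zero.
      splᵉ : Splits e (suc k)
      splᵉ = Splits-summand be bf g≈ spl
      splᶠ : Splits f (suc k)
      splᶠ = Splits-summand bf be (λ i → trans (g≈ i) (+-comm (e i) (f i))) spl

      x y : 𝕃.Carrier
      x = splits⇒𝕃 k be splᵉ
      y = splits⇒𝕃 k bf splᶠ

      factorsˣ : ⟨ _∈ nonzero ⟩ x
      factorsˣ = nonzero-generates x (splits⇒Lₖ𝕀ₖ k x splᵉ)
      factorsʸ : ⟨ _∈ nonzero ⟩ y
      factorsʸ = nonzero-generates y (splits⇒Lₖ𝕀ₖ k y splᶠ)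

      us vs : List 𝕃.Carrier
      us = proj₁ factorsˣ
      vs = proj₁ factorsʸ

      x≈ : x 𝕃.≈ product us
      x≈ = proj₂ (proj₂ factorsˣ)
      y≈ : y 𝕃.≈ product vs
      y≈ = proj₂ (proj₂ factorsʸ)

      us∈ : All (_∈ nonzero) us
      us∈ = proj₁ (proj₂ factorsˣ)
      vs∈ : All (_∈ nonzero) vs
      vs∈ = proj₁ (proj₂ factorsʸ)
      as∈ : All (_∈ nonzero) as
      as∈ = All.++⁻ˡ as ys∈
      bs∈ : All (_∈ nonzero) bs
      bs∈ = All.tail (All.++⁻ʳ as ys∈)

      nonempty : ∀ {a} ws → a 𝕃.≈ product ws → ¬ (a 𝕃.≈ 𝕃.ε) → 1 ≤ length ws
      nonempty []      a≈ε a≢ε = ⊥-elim (a≢ε a≈ε)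
      nonempty (_ ∷ _) _   _   = s≤s z≤n

      longer : length (as ++ g ∷ bs) < length (as ++ us ++ vs ++ bs)
      longer = begin-strict
        length (as ++ g ∷ bs)
          ≡⟨ length-++ as ⟩
        length as + suc (length bs)
          <⟨ +-monoʳ-< (length as) (+-mono-≤ 1≤us (+-monoˡ-≤ (length bs) 1≤vs)) ⟩
        length as + (length us + (length vs + length bs))
          ≡⟨ cong (λ n → length as + (length us + n)) (length-++ vs) ⟨
        length as + (length us + length (vs ++ bs))
          ≡⟨ cong (length as +_) (length-++ us) ⟨
        length as + length (us ++ vs ++ bs)
          ≡⟨ length-++ as ⟨
        length (as ++ us ++ vs ++ bs)
          ∎
        where
        1≤us : 1 ≤ length us
        1≤us = nonempty {x} us x≈ e≢0
        1≤vs : 1 ≤ length vs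
        1≤vs = nonempty {y} vs y≈ f≢0

      z≈′ : z 𝕃.≈ product (as ++ us ++ vs ++ bs)
      z≈′ i = begin-equality
        seq z i
          ≡⟨ z≈ i ⟩
        seq (product (as ++ g ∷ bs)) i
          ≡⟨ product-++ as (g ∷ bs) i ⟩
        A + (seq g i + B)
          ≡⟨ cong (λ n → A + (n + B)) (g≈ i) ⟩
        A + (e i + f i + B)
          ≡⟨ cong (A +_) (+-assoc (e i) (f i) B) ⟩
        A + (e i + (f i + B))
          ≡⟨ cong₂ (λ a b → A + (a + (b + B))) (x≈ i) (y≈ i) ⟩
        A + (seq (product us) i + (seq (product vs) i + B))
          ≡⟨ cong (λ n → A + (seq (product us) i + n)) (product-++ vs bs i) ⟨
        A + (seq (product us) i + seq (product (vs ++ bs)) i)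
          ≡⟨ cong (A +_) (product-++ us (vs ++ bs) i) ⟨
        A + seq (product (us ++ vs ++ bs)) i
          ≡⟨ product-++ as (us ++ vs ++ bs) i ⟨
        seq (product (as ++ us ++ vs ++ bs)) i
          ∎
        where
        A B : ℕ
        A = seq (product as) i
        B = seq (product bs) i

  atoms-generate : Lₖ𝕀ₖ k ⊆ ⟨ Atom∩Lₖ𝕀ₖ k ⟩
  atoms-generate {z} z∈ =
    let ys , max = maximalFactorisation {z} z∈
        ys∈ , z≈ = proj₁ max
        atom = λ {g} (g∈ : g ∈ ys) → let as , bs , eq = ∈-∃++ g∈ in
          factor-atom {z} as g bs (subst (Maximal z) eq max)
    in ys , All.tabulate (λ g∈ → atom g∈ , nonzero⊆ (All.lookup ys∈ g∈)) , z≈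

-- The inductive limit

module Limit {c ℓ} (N : Monoid c ℓ) (inc : Increasing (λ k → ⟨ Lₖ𝕀ₖ k ⟩))
             (f : ∀ i → Hom (InductiveSystem.obj (inclusionSystem 𝕃 Lₖ𝕀ₖ inc) i) N)
             (compat : Compatible (inclusionSystem 𝕃 Lₖ𝕀ₖ inc) N f) where
  open Monoid N renaming (refl to ≈-refl; sym to ≈-sym; trans to ≈-trans)

  -- Both elements are carried to level `i ⊔ j`, where they are equal. So the value depends neither
  -- on the level nor on the proof of membership.
  independent : ∀ i j x y (x∈ : ⟨ Lₖ𝕀ₖ i ⟩ x) (y∈ : ⟨ Lₖ𝕀ₖ j ⟩ y) → x 𝕃.≈ y →
                ⟦ f i ⟧ (x , x∈) ≈ ⟦ f j ⟧ (y , y∈)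
  independent i j x y x∈ y∈ x≈y =
    ≈-trans (≈-sym (compat (m≤m⊔n i j) (x , x∈)))
      (≈-trans (MonoidHomomorphism.⟦⟧-cong (f (i ⊔ j)) x≈y) (compat (m≤n⊔m i j) (y , y∈)))

  -- Read off the data of the element. Equal sequences may carry different lengths, which
  -- `independent` makes harmless.
  level : 𝕃.Carrier → ℕ
  level x = proj₁ (proj₂ x)

  member : ∀ x → ⟨ Lₖ𝕀ₖ (level x) ⟩ x
  member x = singleton∈ (Lₖ𝕀ₖ (level x)) {x} (𝕃-level x)

  mediator : 𝕃.Carrier → Carrier
  mediator x = ⟦ f (level x) ⟧ (x , member x)

  mediator-∙ : ∀ x y → mediator (x 𝕃.∙ y) ≈ mediator x ∙ mediator y
  mediator-∙ x y =
    ≈-trans (independent _ j (x 𝕃.∙ y) (x 𝕃.∙ y) (member (x 𝕃.∙ y)) xy∈ (λ _ → refl))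
      (≈-trans (MonoidHomomorphism.homo (f j) (x , x∈) (y , y∈))
        (∙-cong (independent j _ x x x∈ (member x) (λ _ → refl))
                (independent j _ y y y∈ (member y) (λ _ → refl))))
    where
    j : ℕ
    j = level x ⊔ level y
    x∈ : ⟨ Lₖ𝕀ₖ j ⟩ x
    x∈ = inc (m≤m⊔n (level x) (level y)) {x} (member x)
    y∈ : ⟨ Lₖ𝕀ₖ j ⟩ y
    y∈ = inc (m≤n⊔m (level x) (level y)) {y} (member y)
    xy∈ : ⟨ Lₖ𝕀ₖ j ⟩ (x 𝕃.∙ y)
    xy∈ = ⟨⟩-closed (Lₖ𝕀ₖ j) {x} {y} x∈ y∈

  mediatorHom : Hom 𝕃.monoid N
  mediatorHom = record
    { ⟦_⟧ = mediator
    ; isMonoidHomomorphism = record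
      { isMagmaHomomorphism = record
        { isRelHomomorphism = record
          { cong = λ {x} {y} → independent (level x) (level y) x y (member x) (member y) }
        ; homo = mediator-∙
        }
      ; ε-homo = ≈-trans (independent _ 0 𝕃.ε 𝕃.ε (member 𝕃.ε) ([] , [] , λ _ → refl) (λ _ → refl))
                   (MonoidHomomorphism.ε-homo (f 0))
      }
    }

theorem4p13 : (c ℓ : Level) →
    (Σ[ inc ∈ Increasing (λ k → ⟨ Lₖ𝕀ₖ k ⟩) ]
    IsInductiveLimit (inclusionSystem 𝕃 Lₖ𝕀ₖ inc) c ℓ
    𝕃.monoid (λ k → inclusion 𝕃 (Lₖ𝕀ₖ k)))
    × (∀ k → FinitelyPresented (CommutativeMonoid.monoid ⟨ Lₖ𝕀ₖ k ⟩ᴹ))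
    × Increasing Atom∩Lₖ𝕀ₖ
    × (∀ k → ⟨ Atom∩Lₖ𝕀ₖ k ⟩ ≐ ⟨ Lₖ𝕀ₖ k ⟩)
theorem4p13 c ℓ =
  (inc , record
    { compatible = λ _ _ _ → refl
    ; universal  = λ N f compat → let open Limit N inc f compat in
        mediatorHom ,
        (λ { i (x , x∈) → independent (level x) i x x (member x) x∈ (λ _ → refl) }) ,
        -- Every `x` is the image under inclusion of itself at its own level, so its value under `v`
        -- is forced.
        λ v mediates x → mediates (level x) (x , member x)
    }) ,
  presentation ,
  (λ {i} {j} i≤j {x} (atom , x∈) → atom , Lₖ𝕀ₖ-increasing {i} {j} i≤j {x} x∈) ,
  λ k → (λ {x} → ⟨⟩-mono {A = Atom∩Lₖ𝕀ₖ k} {B = Lₖ𝕀ₖ k} proj₂ {x}) ,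
        (λ {x} → ⟨⟩-bind {A = Lₖ𝕀ₖ k} {B = Atom∩Lₖ𝕀ₖ k} (λ {z} → atoms-generate k {z}) {x})
  where
  inc : Increasing (λ k → ⟨ Lₖ𝕀ₖ k ⟩)
  inc {i} {j} i≤j {x} = ⟨⟩-mono {A = Lₖ𝕀ₖ i} {B = Lₖ𝕀ₖ j} (λ {z} → Lₖ𝕀ₖ-increasing i≤j {z}) {x}
  module _ (k : ℕ) where
    open FixedLength k (suc k !) (suc (suc k + suc k * suc k)) {{suc k !≢0}} (s≤s z≤n)
      (uniformlyAdditive k) using (presentation; atoms-generate) public
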